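{- Let $b$ and $n$ be positive integers and let $T$ be a non-empty subset of $[n]=\{1,\dots,n\}$ such that $\max(T)+3b\le 2n<4b$. Then the independence number of the graph $\Gamma(n,T\cup\{b\})$ equals $\binom{n-1}{b}\cdot |V\Gamma(b,T)|$, where $|V\Gamma(b,T)|$ denotes the number of flags of $[b]$ of type $T$.
   Context: For an integer $n\ge 0$, $[n]:=\{i\in\mathbb Z: 1\le i\le n\}$. Let $S$ be a non-empty finite set. Two subsets $X,Y$ of $S$ are in general position (with respect to $S$) if $X\cup Y=S$ or $X\cap Y=\emptyset$. A flag of $S$ is a set $f$ of non-empty proper subsets of $S$ such that $X\subseteq Y$ or $Y\subseteq X$ for all $X,Y\in f$; its type is $\{|X|: X\in f\}$. Two flags $f,f'$ of $S$ are in general position if $X$ and $X'$ are in general position for all $X\in f$, $X'\in f'$. For $T\subseteq[|S|-1]$, $\Gamma(S,T)$ is the graph whose vertices are the flags of $S$ of type $T$, two vertices being adjacent iff the flags are in general position; $\Gamma(n,T):=\Gamma([n],T)$, and $V\Gamma$ denotes the vertex set of a graph $\Gamma$. The independence number of a graph is the maximum size of a set of pairwise non-adjacent vertices. -}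

module Defs where

open import Data.Nat using (ℕ; zero; suc; _+_; _*_; _∸_; _≤_; _<_)
open import Data.Bool using (Bool; true; false)
open import Data.Fin using (Fin; toℕ)
open import Data.Fin.Subset using (Subset; _∪_; _∩_; ⊤; ⊥; _⊆_; ∣_∣; _∈_)
open import Data.List using (List; length)
open import Data.List.Relation.Unary.AllPairs using (AllPairs)
open import Data.List.Membership.Propositional using () renaming (_∈_ to _∈L_)
open import Data.List.Relation.Unary.Any using (Any)
open import Data.Product using (Σ; ∃; _×_; _,_; proj₁)
open import Data.Sum using (_⊎_)
open import Relation.Nullary using (¬_)
open import Relation.Binary.PropositionalEquality using (_≡_)

-- Subsets of [m] are modelled by 'Subset m' (element i : Fin m stands for i+1).
-- A set of subsets of [m] is modelled by its characteristic function.
SetOfSubsets : ℕ → Set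
SetOfSubsets m = Subset m → Bool

_≐_ : ∀ {m} → SetOfSubsets m → SetOfSubsets m → Set
f ≐ g = ∀ X → f X ≡ g X

IsFlag : (m : ℕ) → SetOfSubsets m → Set
IsFlag m f =
  (∀ X → f X ≡ true → (0 < ∣ X ∣) × (∣ X ∣ < m)) ×
  (∀ X Y → f X ≡ true → f Y ≡ true → (X ⊆ Y) ⊎ (Y ⊆ X))

HasType : (m : ℕ) → SetOfSubsets m → (ℕ → Set) → Set
HasType m f Ty =
  (∀ X → f X ≡ true → Ty ∣ X ∣) ×
  (∀ k → Ty k → ∃ λ X → (f X ≡ true) × (∣ X ∣ ≡ k))

FlagOfType : (m : ℕ) → (ℕ → Set) → Set
FlagOfType m Ty = Σ (SetOfSubsets m) λ f → IsFlag m f × HasType m f Ty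

GenPosSets : ∀ {m} → Subset m → Subset m → Set
GenPosSets X Y = (X ∪ Y ≡ ⊤) ⊎ (X ∩ Y ≡ ⊥)

GenPos : ∀ {m} → SetOfSubsets m → SetOfSubsets m → Set
GenPos f g = ∀ X Y → f X ≡ true → g Y ≡ true → GenPosSets X Y

Vtx : ℕ → (ℕ → Set) → Set
Vtx = FlagOfType

_≈V_ : ∀ {m Ty} → Vtx m Ty → Vtx m Ty → Set
u ≈V v = proj₁ u ≐ proj₁ v

Adj : ∀ {m Ty} → Vtx m Ty → Vtx m Ty → Set
Adj u v = GenPos (proj₁ u) (proj₁ v)

IsIndependent : ∀ {m Ty} → List (Vtx m Ty) → Set
IsIndependent = AllPairs (λ u v → ¬ (u ≈V v) × ¬ Adj u v)

IndependenceNumber : (m : ℕ) → (ℕ → Set) → ℕ → Set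
IndependenceNumber m Ty α =
  (∃ λ (vs : List (Vtx m Ty)) → IsIndependent vs × length vs ≡ α) ×
  (∀ (vs : List (Vtx m Ty)) → IsIndependent vs → length vs ≤ α)

NumVertices : (m : ℕ) → (ℕ → Set) → ℕ → Set
NumVertices m Ty c =
  ∃ λ (vs : List (Vtx m Ty)) →
    AllPairs (λ u v → ¬ (u ≈V v)) vs ×
    (∀ (v : Vtx m Ty) → Any (λ w → v ≈V w) vs) ×
    length vs ≡ c

⟦_⟧ : ∀ {n} → Subset n → ℕ → Set
⟦_⟧ {n} T k = ∃ λ (i : Fin n) → (i ∈ T) × (suc (toℕ i) ≡ k)

_∪｛_｝ : (ℕ → Set) → ℕ → ℕ → Set
(Ty ∪｛ b ｝) k = Ty k ⊎ (k ≡ b)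

{-# OPTIONS --safe #-}
module Submission where

-- Put a = n − b, so that 0 < a < b, and t + b ≤ 2a for all t ∈ T. A vertex is a b-subset B with a
-- flag of type T inside it. Since 2b > n, flags whose b-subsets miss a common point are never in
-- general position, which gives the lower bound.
-- For the upper bound, place the points on a circle in some order. Each of its n rotations yields
-- a vertex: B is an arc of length b and the members of the flag are arcs in the middle part of B. By
-- t + b ≤ 2a these middle arcs lie in every arc of length a contained in B, so two such vertices are
-- in general position as soon as the complements of their arcs B are disjoint; by Katona's argument
-- an independent set contains at most a of the n vertices. All vertices occur in equally many orders,
-- so averaging over the orders bounds an independent set by a/n times the number of vertices, and
-- a · (n C b) = n · ((n − 1) C b).

open import Defs
open import Data.Nat using (ℕ; zero; suc; _+_; _*_; _∸_; _≤_; _<_; _<ᵇ_; _%_; z≤n; s≤s; _<?_; _≤?_; NonZero; >-nonZero)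
open import Data.Nat.Properties hiding (_≟_)
open import Data.Nat.Combinatorics using (_C_; nC1≡n; nCk+nC[k+1]≡[n+1]C[k+1])
open import Data.Nat.DivMod using (%-distribˡ-+; m%n%n≡m%n; m<n⇒m%n≡m; [m+n]%n≡m%n; m%n<n)
open import Data.Nat.ListAction using (sum)
open import Data.Nat.Tactic.RingSolver using (solve-∀)
open import Data.Bool as Bool using (Bool; true; false; _∧_; _∨_)
import Data.Bool.Properties as Bool
open import Data.Fin as Fin using (Fin; zero; suc; toℕ; fromℕ<; punchIn)
import Data.Fin.Properties as Fin
open import Data.Fin.Permutation as Perm
  using (Permutation′; permutation; _⟨$⟩ʳ_; _⟨$⟩ˡ_; inverseˡ; inverseʳ; flip; _∘ₚ_; insert; insert-punchIn)
open import Data.Fin.Subset using (Subset; _⊆_; _∈_; ∣_∣; ⊥; ⊤; _∩_; ∁)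
import Data.Fin.Subset.Properties as Subset
open import Data.Fin.Subset.Properties using (_∈?_; ⊆-antisym; ∉⊥)
open import Data.List
  using (List; []; _∷_; _++_; length; map; filter; lookup; cartesianProduct; cartesianProductWith; allFin)
open import Data.List.Properties using (length-map; length-++; length-tabulate; filter-some)
open import Data.List.Relation.Unary.All as All using (All; []; _∷_)
import Data.List.Relation.Unary.All.Properties as All
open import Data.List.Relation.Unary.Any as Any using (Any; here; there; index)
open import Data.List.Relation.Unary.Any.Properties using (lookup-index)
open import Data.List.Relation.Unary.AllPairs as AllPairs using (AllPairs; []; _∷_)
import Data.List.Relation.Unary.AllPairs.Properties as AllPairs
open import Data.List.Relation.Unary.Unique.Propositional using (Unique)
import Data.List.Relation.Unary.Unique.Propositional.Properties as Unique
open import Data.List.Membership.Propositional using (find; lose) renaming (_∈_ to _∈ˡ_)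
open import Data.List.Membership.Propositional.Properties
  using (∈-lookup; ∈-length; ∈-filter⁺; ∈-filter⁻; ∈-map⁺; ∈-map⁻; ∈-++⁺ˡ; ∈-++⁺ʳ; ∈-allFin;
         ∈-cartesianProduct⁺; ∈-cartesianProductWith⁺)
open import Data.Vec as Vec using (Vec; []; _∷_; tabulate)
import Data.Vec.Properties as Vec
open import Data.Vec.Properties using (lookup∘tabulate; tabulate∘lookup; tabulate-cong; lookup⇒[]=; []=⇒lookup)
open import Data.Product using (∃; _×_; _,_; proj₁; proj₂)
open import Data.Sum as Sum using (_⊎_; inj₁; inj₂; reduce)
open import Function using (_∘_; id; mk⇔)
open import Function.Bundles using (Equivalence)
open import Function.Definitions using (Injective)
open import Level using (Level)
open import Relation.Nullary using (Dec; yes; no; does; ¬_; contradiction; decidable-stable; _×-dec_; _→-dec_)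
open import Relation.Nullary.Decidable using (dec-true)
open import Relation.Unary using (Pred)
import Relation.Unary as U
import Relation.Binary as B
open import Relation.Binary using (Rel; Symmetric; Total; Transitive)
open import Relation.Binary.PropositionalEquality
  using (_≡_; _≢_; refl; sym; trans; cong; cong₂; subst; subst₂; module ≡-Reasoning)
import Algebra.Properties.CommutativeMonoid.Sum +-0-commutativeMonoid as FinSum

private variable
  ℓ ℓ₁ ℓ₂ ℓ₃ : Level
  A : Set ℓ
  k m n : ℕ

-- Finite counting

AllPairs-lookup : {R : Rel A ℓ} {xs : List A} → Symmetric R → AllPairs R xs →
  ∀ {i j} → i ≢ j → R (lookup xs i) (lookup xs j)
AllPairs-lookup s (r ∷ rs) {zero}  {zero}  i≢j = contradiction refl i≢j
AllPairs-lookup s (r ∷ rs) {zero}  {suc j} i≢j = All.lookup r (∈-lookup j)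
AllPairs-lookup s (r ∷ rs) {suc i} {zero}  i≢j = s (All.lookup r (∈-lookup i))
AllPairs-lookup s (r ∷ rs) {suc i} {suc j} i≢j = AllPairs-lookup s rs (i≢j ∘ cong suc)

Unique-lookup-injective : {xs : List A} → Unique xs → Injective _≡_ _≡_ (lookup xs)
Unique-lookup-injective u {i} {j} eq with i Fin.≟ j
... | yes i≡j = i≡j
... | no  i≢j = contradiction eq (AllPairs-lookup (λ x≢y → x≢y ∘ sym) u i≢j)

injectiveOn⇒length≤ : {xs : List A} → Unique xs → (g : A → ℕ) (k : ℕ) →
  (∀ {x} → x ∈ˡ xs → g x < k) →
  (∀ {x y} → x ∈ˡ xs → y ∈ˡ xs → g x ≡ g y → x ≡ y) → length xs ≤ k
injectiveOn⇒length≤ {xs = xs} u g k g<k inj =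
  Fin.injective⇒≤ {f = λ i → fromℕ< (g<k (∈-lookup {xs = xs} i))} λ {i} {j} eq →
    Unique-lookup-injective u (inj (∈-lookup i) (∈-lookup j) (Fin.fromℕ<-injective _ _ _ _ eq))

Unique-⊆⇒length≤ : {xs ys : List A} → Unique xs → (∀ {x} → x ∈ˡ xs → x ∈ˡ ys) →
  length xs ≤ length ys
Unique-⊆⇒length≤ {xs = xs} {ys} u sub = Fin.injective⇒≤ {f = f} λ {i} {j} eq →
  Unique-lookup-injective u (trans (f-lookup i) (trans (cong (lookup ys) eq) (sym (f-lookup j))))
  where
  f = λ i → index (sub (∈-lookup {xs = xs} i))
  f-lookup : ∀ i → lookup xs i ≡ lookup ys (f i)
  f-lookup i = lookup-index (sub (∈-lookup {xs = xs} i))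

-- The image of the first filtered list under `φ` has no repetitions and lies in the second. With a
-- translation of permutations as `φ`, it compares how many orders fit two flags.
filter-injection : {P : Pred A ℓ₁} {Q : Pred A ℓ₂} (P? : U.Decidable P) (Q? : U.Decidable Q)
  {xs : List A} → Unique xs → (φ : A → A) → Injective _≡_ _≡_ φ →
  (∀ {x} → x ∈ˡ xs → P x → φ x ∈ˡ xs × Q (φ x)) →
  length (filter P? xs) ≤ length (filter Q? xs)
filter-injection P? Q? {xs} u φ inj h =
  subst (_≤ length (filter Q? xs)) (length-map φ (filter P? xs))
    (Unique-⊆⇒length≤ (Unique.map⁺ inj (Unique.filter⁺ P? u)) λ y∈ →
      let x , x∈ , y≡ = ∈-map⁻ φ y∈
          x∈xs , px = ∈-filter⁻ P? {xs = xs} x∈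
          φx∈ , qx = h x∈xs px
      in subst (_∈ˡ _) (sym y≡) (∈-filter⁺ Q? φx∈ qx))

module DoubleCounting {A : Set ℓ₁} {B : Set ℓ₂} {R : A → B → Set ℓ} (R? : B.Decidable R) where

  row : List B → A → ℕ
  row ys x = length (filter (R? x) ys)

  column : List A → B → ℕ
  column xs y = length (filter (λ x → R? x y) xs)

  incidences : List A → List B → ℕ
  incidences xs ys = sum (map (row ys) xs)

  -- Exchange of summation, one column at a time: `incidences` is defined by rows, and this peels
  -- off the column of `y`.
  incidences-∷ : ∀ xs y ys → incidences xs (y ∷ ys) ≡ column xs y + incidences xs ys
  incidences-∷ []       y ys = refl
  incidences-∷ (x ∷ xs) y ys with R? x y
  ... | yes r = begin
    suc (row ys x) + incidences xs (y ∷ ys)                ≡⟨ cong (suc (row ys x) +_) (incidences-∷ xs y ys) ⟩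
    suc (row ys x) + (column xs y + incidences xs ys)      ≡⟨ lem (row ys x) (column xs y) (incidences xs ys) ⟩
    suc (column xs y) + (row ys x + incidences xs ys)      ∎
    where open ≡-Reasoning
          lem : ∀ r c i → suc r + (c + i) ≡ suc c + (r + i)
          lem = solve-∀
  ... | no ¬r = begin
    row ys x + incidences xs (y ∷ ys)                ≡⟨ cong (row ys x +_) (incidences-∷ xs y ys) ⟩
    row ys x + (column xs y + incidences xs ys)      ≡⟨ lem (row ys x) (column xs y) (incidences xs ys) ⟩
    column xs y + (row ys x + incidences xs ys)      ∎
    where open ≡-Reasoning
          lem : ∀ r c i → r + (c + i) ≡ c + (r + i)
          lem = solve-∀

  incidences-[] : ∀ xs → incidences xs [] ≡ 0
  incidences-[] []       = refl
  incidences-[] (x ∷ xs) = incidences-[] xs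

  incidences-≥ : ∀ {k} xs ys → (∀ {x} → x ∈ˡ xs → k ≤ row ys x) → length xs * k ≤ incidences xs ys
  incidences-≥ []       ys h = z≤n
  incidences-≥ (x ∷ xs) ys h = +-mono-≤ (h (here refl)) (incidences-≥ xs ys (h ∘ there))

  incidences-≤ : ∀ {k} xs ys → (∀ {y} → y ∈ˡ ys → column xs y ≤ k) → incidences xs ys ≤ length ys * k
  incidences-≤ xs []       h = ≤-reflexive (incidences-[] xs)
  incidences-≤ xs (y ∷ ys) h = subst (_≤ _) (sym (incidences-∷ xs y ys))
    (+-mono-≤ (h (here refl)) (incidences-≤ xs ys (h ∘ there)))

  -- Both products bound the same number of incidences, counted by rows and by columns. The upper
  -- bound uses it twice: for pairs of vertex and rotation against orders, and for orders against
  -- flags.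
  doubleCounting : ∀ {k l} xs ys → (∀ {x} → x ∈ˡ xs → k ≤ row ys x) →
    (∀ {y} → y ∈ˡ ys → column xs y ≤ l) → length xs * k ≤ length ys * l
  doubleCounting xs ys h h′ = ≤-trans (incidences-≥ xs ys h) (incidences-≤ xs ys h′)

open DoubleCounting using (doubleCounting)

-- Absorption identities for binomial coefficients

[1+k]*nC[1+k]≡n*[n-1]Ck : ∀ n k → suc k * (suc n C suc k) ≡ suc n * (n C k)
[1+k]*nC[1+k]≡n*[n-1]Ck zero    zero    = refl
[1+k]*nC[1+k]≡n*[n-1]Ck zero    (suc k) = *-zeroʳ k
[1+k]*nC[1+k]≡n*[n-1]Ck (suc n) zero    = trans (*-identityˡ _) (trans (nC1≡n (suc (suc n))) (sym (*-identityʳ _)))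
[1+k]*nC[1+k]≡n*[n-1]Ck (suc n) (suc k) = begin
  suc (suc k) * (suc (suc n) C suc (suc k))
    ≡⟨ cong (suc (suc k) *_) (sym (nCk+nC[k+1]≡[n+1]C[k+1] (suc n) (suc k))) ⟩
  suc (suc k) * (x + (suc n C suc (suc k)))
    ≡⟨ lem₁ k x _ ⟩
  suc k * x + suc (suc k) * (suc n C suc (suc k)) + x
    ≡⟨ cong₂ (λ u v → u + v + x) ([1+k]*nC[1+k]≡n*[n-1]Ck n k) ([1+k]*nC[1+k]≡n*[n-1]Ck n (suc k)) ⟩
  suc n * (n C k) + suc n * (n C suc k) + x
    ≡⟨ lem₂ n (n C k) (n C suc k) x ⟩
  suc n * (n C k + n C suc k) + x
    ≡⟨ cong (λ u → suc n * u + x) (nCk+nC[k+1]≡[n+1]C[k+1] n k) ⟩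
  suc n * x + x
    ≡⟨ +-comm (suc n * x) x ⟩
  suc (suc n) * x ∎
  where
  open ≡-Reasoning
  x = suc n C suc k
  lem₁ : ∀ k x y → suc (suc k) * (x + y) ≡ suc k * x + suc (suc k) * y + x
  lem₁ = solve-∀
  lem₂ : ∀ n x y z → suc n * x + suc n * y + z ≡ suc n * (x + y) + z
  lem₂ = solve-∀

-- After adding `suc n * (n C k)` to both sides, the previous identity turns the left side into
-- `(suc k + a) * x = suc n * x`, and Pascal's rule splits this into the right side.
[n-k]*nCk≡n*[n-1]Ck : ∀ n a k → suc n ≡ a + k → a * (suc n C k) ≡ suc n * (n C k)
[n-k]*nCk≡n*[n-1]Ck n a zero eq = cong (_* 1) (trans (sym (+-identityʳ a)) (sym eq))
[n-k]*nCk≡n*[n-1]Ck n a (suc k) eq = +-cancelˡ-≡ (suc n * (n C k)) _ _ (begin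
  suc n * (n C k) + a * x     ≡⟨ cong (_+ a * x) (sym ([1+k]*nC[1+k]≡n*[n-1]Ck n k)) ⟩
  suc k * x + a * x           ≡⟨ sym (*-distribʳ-+ x (suc k) a) ⟩
  (suc k + a) * x             ≡⟨ cong (_* x) (trans (+-comm (suc k) a) (sym eq)) ⟩
  suc n * x                   ≡⟨ cong (suc n *_) (sym (nCk+nC[k+1]≡[n+1]C[k+1] n k)) ⟩
  suc n * (n C k + n C suc k) ≡⟨ *-distribˡ-+ (suc n) (n C k) (n C suc k) ⟩
  suc n * (n C k) + suc n * (n C suc k) ∎)
  where
  open ≡-Reasoning
  x = suc n C suc k

-- Sorting along a total preorder

module Sorting {A : Set ℓ₁} {_≼_ : Rel A ℓ} (total : Total _≼_) (≼-trans : Transitive _≼_) where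

  ≼-refl : ∀ {x} → x ≼ x
  ≼-refl {x} = reduce (total x x)

  minimum : ∀ {n} (f : Fin (suc n) → A) → ∃ λ m → ∀ i → f m ≼ f i
  minimum {zero}  f = zero , λ { zero → ≼-refl }
  minimum {suc n} f with m , m≼ ← minimum (f ∘ suc) | total (f zero) (f (suc m))
  ... | inj₁ 0≼m = zero , λ { zero → ≼-refl ; (suc i) → ≼-trans 0≼m (m≼ i) }
  ... | inj₂ m≼0 = suc m , λ { zero → m≼0 ; (suc i) → m≼ i }

  -- Selection sort: the index `m` of a minimum goes to position 0, and `punchIn m` identifies the
  -- remaining indices with `Fin n` for the recursive call. Ties are allowed, as points that no
  -- member of a chain separates are tied.
  sorting : ∀ n (f : Fin n → A) → ∃ λ (σ : Permutation′ n) →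
    ∀ {i j} → i Fin.≤ j → f (σ ⟨$⟩ʳ i) ≼ f (σ ⟨$⟩ʳ j)
  sorting zero    f = Perm.id , λ { {()} }
  sorting (suc n) f with m , m≼ ← minimum f | σ , mono ← sorting n (f ∘ punchIn (proj₁ (minimum f))) =
    τ , λ {i} {j} → τ-mono i j
    where
    τ = insert zero m σ
    τ-mono : ∀ i j → i Fin.≤ j → f (τ ⟨$⟩ʳ i) ≼ f (τ ⟨$⟩ʳ j)
    τ-mono zero    j       _         = m≼ _
    τ-mono (suc i) (suc j) (s≤s i≤j) = subst₂ (λ x y → f x ≼ f y)
      (sym (insert-punchIn zero m σ i)) (sym (insert-punchIn zero m σ j)) (mono i≤j)

-- Subsets and permutations of Fin n

-- Pulling back is composition of the characteristic vector with `r`, so composites are handled by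
-- `preimage-∘` and no inverse of `r` enters.
preimage : (Fin m → Fin n) → Subset n → Subset m
preimage r X = tabulate (Vec.lookup X ∘ r)

∈-preimage⁺ : {r : Fin m → Fin n} {X : Subset n} {x : Fin m} → r x ∈ X → x ∈ preimage r X
∈-preimage⁺ {r = r} {X} {x} rx∈X = lookup⇒[]= x _ (trans (lookup∘tabulate _ x) ([]=⇒lookup rx∈X))

∈-preimage⁻ : {r : Fin m → Fin n} {X : Subset n} {x : Fin m} → x ∈ preimage r X → r x ∈ X
∈-preimage⁻ {r = r} {X} {x} x∈ = lookup⇒[]= (r x) X (trans (sym (lookup∘tabulate _ x)) ([]=⇒lookup x∈))

preimage-mono : (r : Fin m → Fin n) {X Y : Subset n} → X ⊆ Y → preimage r X ⊆ preimage r Y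
preimage-mono r {X} {Y} X⊆Y x∈ = ∈-preimage⁺ {r = r} {Y} (X⊆Y (∈-preimage⁻ {r = r} {X} x∈))

preimage-cong : {r s : Fin m → Fin n} → (∀ x → r x ≡ s x) → ∀ X → preimage r X ≡ preimage s X
preimage-cong r≗s X = tabulate-cong (cong (Vec.lookup X) ∘ r≗s)

preimage-∘ : ∀ {o} (r : Fin m → Fin n) (s : Fin n → Fin o) X →
  preimage r (preimage s X) ≡ preimage (s ∘ r) X
preimage-∘ r s X = tabulate-cong (λ x → lookup∘tabulate _ (r x))

private
  indicator : Bool → ℕ
  indicator true  = 1
  indicator false = 0

∣∣≡sum : (X : Subset n) → ∣ X ∣ ≡ FinSum.sum (indicator ∘ Vec.lookup X)
∣∣≡sum []          = refl
∣∣≡sum (true  ∷ X) = cong suc (∣∣≡sum X)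
∣∣≡sum (false ∷ X) = ∣∣≡sum X

-- The size is a sum of indicators, and `sum-permute` reorders its terms.
∣preimage∣ : (π : Permutation′ n) (X : Subset n) → ∣ preimage (π ⟨$⟩ʳ_) X ∣ ≡ ∣ X ∣
∣preimage∣ π X = begin
  ∣ preimage (π ⟨$⟩ʳ_) X ∣                                   ≡⟨ ∣∣≡sum (preimage (π ⟨$⟩ʳ_) X) ⟩
  FinSum.sum (indicator ∘ Vec.lookup (preimage (π ⟨$⟩ʳ_) X))    ≡⟨ FinSum.sum-cong-≗ (λ x → cong indicator (lookup∘tabulate (Vec.lookup X ∘ (π ⟨$⟩ʳ_)) x)) ⟩
  FinSum.sum (indicator ∘ Vec.lookup X ∘ (π ⟨$⟩ʳ_))             ≡⟨ sym (FinSum.sum-permute (indicator ∘ Vec.lookup X) π) ⟩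
  FinSum.sum (indicator ∘ Vec.lookup X)                         ≡⟨ sym (∣∣≡sum X) ⟩
  ∣ X ∣                                                      ∎
  where open ≡-Reasoning

-- The interval `[s , s + k)`. The condition `s ≤ toℕ p` is spelled with `_<ᵇ_` so that both tests
-- compute when `n` and `s` lose a successor, which drives the induction in `∣window∣`.
window : ∀ n → ℕ → ℕ → Subset n
window n s k = tabulate λ p → (s <ᵇ suc (toℕ p)) ∧ (toℕ p <ᵇ s + k)

prefix : ∀ n → ℕ → Subset n
prefix n k = window n 0 k

∈-window⁺ : ∀ {s k} {p : Fin n} → s ≤ toℕ p → toℕ p < s + k → p ∈ window n s k
∈-window⁺ {p = p} s≤p p<s+k = lookup⇒[]= p _ (trans (lookup∘tabulate _ p)
  (cong₂ _∧_ (Equivalence.to Bool.T-≡ (<⇒<ᵇ (s≤s s≤p))) (Equivalence.to Bool.T-≡ (<⇒<ᵇ p<s+k))))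

∈-window⁻ : ∀ {s k} {p : Fin n} → p ∈ window n s k → s ≤ toℕ p × toℕ p < s + k
∈-window⁻ {s = s} {k} {p} p∈ with eq ← trans (sym (lookup∘tabulate _ p)) ([]=⇒lookup p∈) =
  ≤-pred (<ᵇ⇒< s _ (Equivalence.from Bool.T-≡ (Bool.∧-conicalˡ _ _ eq))) ,
  <ᵇ⇒< _ _ (Equivalence.from Bool.T-≡ (Bool.∧-conicalʳ (s <ᵇ suc (toℕ p)) _ eq))

∣window∣ : ∀ n s k → s + k ≤ n → ∣ window n s k ∣ ≡ k
∣window∣ zero    zero    zero    _         = refl
∣window∣ (suc n) zero    zero    _         = ∣window∣ n zero zero z≤n
∣window∣ (suc n) zero    (suc k) (s≤s k≤n) = cong suc (∣window∣ n zero k k≤n)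
∣window∣ (suc n) (suc s) k       (s≤s h)   = ∣window∣ n s k h

∣prefix∣ : ∀ n k → k ≤ n → ∣ prefix n k ∣ ≡ k
∣prefix∣ n k = ∣window∣ n 0 k

prefix-mono : ∀ {j k} → j ≤ k → prefix n j ⊆ prefix n k
prefix-mono {n} {j} {k} j≤k p∈ = ∈-window⁺ {s = 0} {k} z≤n (≤-trans (proj₂ (∈-window⁻ {s = 0} {j} p∈)) j≤k)

downClosed⇒prefix : (D : Subset n) → (∀ {i j} → i Fin.≤ j → j ∈ D → i ∈ D) → D ≡ prefix n ∣ D ∣
downClosed⇒prefix []          down = refl
downClosed⇒prefix (true  ∷ D) down = cong (true ∷_)
  (downClosed⇒prefix D λ i≤j j∈D → Subset.drop-there (down (s≤s i≤j) (Vec.there j∈D)))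
-- If 0 is outside, down-closure leaves nothing above it, so `D` is empty and both sides are the
-- empty set.
downClosed⇒prefix {suc n} (false ∷ D) down
  rewrite Subset.Empty-unique {p = D} (λ (j , j∈D) → contradiction (down {zero} {suc j} z≤n (Vec.there j∈D)) λ ())
        | Subset.∣⊥∣≡0 n = cong (false ∷_) (sym (Subset.Empty-unique λ (p , p∈) →
            contradiction (proj₂ (∈-window⁻ {s = 0} {0} p∈)) λ ()))

⊆∧∣∣≡⇒≡ : {X Y : Subset n} → X ⊆ Y → ∣ X ∣ ≡ ∣ Y ∣ → X ≡ Y
⊆∧∣∣≡⇒≡ {X = X} {Y} X⊆Y eq = ⊆-antisym X⊆Y λ {x} x∈Y → decidable-stable (x ∈? X) λ x∉X →
  <-irrefl eq (Subset.p⊂q⇒∣p∣<∣q∣ (X⊆Y , x , x∈Y , x∉X))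

-- Chains of subsets as prefixes of an order

module Straightening (Xs : List (Subset n)) (chain : ∀ {X Y} → X ∈ˡ Xs → Y ∈ˡ Xs → X ⊆ Y ⊎ Y ⊆ X) where

  -- The preorder for which all members of the chain are down-closed: `x` enters the chain no later
  -- than `y`.
  _≼_ : Fin n → Fin n → Set
  x ≼ y = All (λ X → y ∈ X → x ∈ X) Xs

  -- If `x ≼ y` fails, some member `X` contains `y` but not `x`. A member containing `x` is then not
  -- inside `X`, hence contains `X` and with it `y`; so `y ≼ x`.
  ≼-total : ∀ x y → x ≼ y ⊎ y ≼ x
  ≼-total x y with All.all? (λ X → (y ∈? X) →-dec (x ∈? X)) Xs
  ... | yes x≼y = inj₁ x≼y
  ... | no ¬x≼y with X , X∈ , ¬h ← find (All.¬All⇒Any¬ (λ X → (y ∈? X) →-dec (x ∈? X)) Xs ¬x≼y)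
               with y ∈? X | x ∈? X
  ... | no y∉X  | _       = contradiction (λ y∈X → contradiction y∈X y∉X) ¬h
  ... | yes _   | yes x∈X = contradiction (λ _ → x∈X) ¬h
  ... | yes y∈X | no x∉X  = inj₂ (All.tabulate λ Z∈ x∈Z → case Z∈ x∈Z (chain Z∈ X∈))
    where
    case : ∀ {Z} → Z ∈ˡ Xs → x ∈ Z → Z ⊆ X ⊎ X ⊆ Z → y ∈ Z
    case _ x∈Z (inj₁ Z⊆X) = contradiction (Z⊆X x∈Z) x∉X
    case _ x∈Z (inj₂ X⊆Z) = X⊆Z y∈X

  ≼-trans : ∀ {x y z} → x ≼ y → y ≼ z → x ≼ z
  ≼-trans x≼y y≼z = All.zipWith (λ (f , g) → f ∘ g) (x≼y , y≼z)

  -- Sort the points by `_≼_`. The sorting permutation sends positions to points and makes each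
  -- member a down-closed set of positions, hence a prefix. Its inverse, from points to positions,
  -- pulls that prefix back to the member.
  straighten : ∃ λ (σ : Permutation′ n) → ∀ {X} → X ∈ˡ Xs → preimage (σ ⟨$⟩ʳ_) (prefix n ∣ X ∣) ≡ X
  straighten with σ , mono ← Sorting.sorting ≼-total ≼-trans n id = flip σ , λ {X} X∈ → begin
    preimage (σ ⟨$⟩ˡ_) (prefix n ∣ X ∣)
      ≡⟨ cong (λ k → preimage (σ ⟨$⟩ˡ_) (prefix n k)) (sym (∣preimage∣ σ X)) ⟩
    preimage (σ ⟨$⟩ˡ_) (prefix n ∣ preimage (σ ⟨$⟩ʳ_) X ∣)
      ≡⟨ cong (preimage (σ ⟨$⟩ˡ_)) (sym (downClosed⇒prefix _ λ i≤j j∈ →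
           ∈-preimage⁺ {r = σ ⟨$⟩ʳ_} {X} (All.lookup (mono i≤j) X∈ (∈-preimage⁻ {r = σ ⟨$⟩ʳ_} {X} j∈)))) ⟩
    preimage (σ ⟨$⟩ˡ_) (preimage (σ ⟨$⟩ʳ_) X)
      ≡⟨ preimage-∘ (σ ⟨$⟩ˡ_) (σ ⟨$⟩ʳ_) X ⟩
    preimage (λ x → σ ⟨$⟩ʳ (σ ⟨$⟩ˡ x)) X
      ≡⟨ preimage-cong (λ x → inverseʳ σ) X ⟩
    preimage id X
      ≡⟨ tabulate∘lookup X ⟩
    X ∎
    where open ≡-Reasoning

open Straightening using (straighten)

-- Enumerating subsets and permutations

vectors : {A : Set ℓ} → List A → ∀ k → List (Vec A k)
vectors xs zero    = [] ∷ []
vectors xs (suc k) = cartesianProductWith _∷_ xs (vectors xs k)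

∈-vectors : {A : Set ℓ} {xs : List A} → (∀ x → x ∈ˡ xs) → ∀ {k} (v : Vec A k) → v ∈ˡ vectors xs k
∈-vectors all []      = here refl
∈-vectors all (x ∷ v) = ∈-cartesianProductWith⁺ _∷_ (all x) (∈-vectors all v)

vectors-unique : {A : Set ℓ} {xs : List A} → Unique xs → ∀ k → Unique (vectors xs k)
vectors-unique u zero    = [] ∷ []
vectors-unique u (suc k) = Unique.cartesianProductWith⁺ _∷_ Vec.∷-injective u (vectors-unique u k)

subsets : ∀ n → List (Subset n)
subsets = vectors (true ∷ false ∷ [])

∈-subsets : (X : Subset n) → X ∈ˡ subsets n
∈-subsets = ∈-vectors λ { true → here refl ; false → there (here refl) }

-- A permutation is coded by its table of values and that of its inverse, since on codes
-- propositional equality is extensional.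
Code : ℕ → Set
Code n = Vec (Fin n) n × Vec (Fin n) n

⟪_⟫ : Code n → Fin n → Fin n
⟪ c ⟫ = Vec.lookup (proj₁ c)

IsPermutation : Code n → Set
IsPermutation (u , v) = (∀ i → Vec.lookup v (Vec.lookup u i) ≡ i) × (∀ i → Vec.lookup u (Vec.lookup v i) ≡ i)

isPermutation? : U.Decidable (IsPermutation {n})
isPermutation? (u , v) = Fin.all? (λ i → _ Fin.≟ i) ×-dec Fin.all? (λ i → _ Fin.≟ i)

codes : ∀ n → List (Code n)
codes n = filter isPermutation? (cartesianProduct (vectors (allFin n) n) (vectors (allFin n) n))

codes-unique : ∀ n → Unique (codes n)
codes-unique n = Unique.filter⁺ isPermutation?
  (Unique.cartesianProduct⁺ (vectors-unique (Unique.allFin⁺ n) n) (vectors-unique (Unique.allFin⁺ n) n))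

∈-codes : {c : Code n} → IsPermutation c → c ∈ˡ codes n
∈-codes = ∈-filter⁺ isPermutation? (∈-cartesianProduct⁺ (∈-vectors ∈-allFin _) (∈-vectors ∈-allFin _))

toPermutation : {c : Code n} → c ∈ˡ codes n → Permutation′ n
toPermutation {n} {c = c} c∈ with _ , vu , uv ← ∈-filter⁻ isPermutation? {xs = cartesianProduct (vectors (allFin n) n) (vectors (allFin n) n)} c∈ =
  permutation ⟪ c ⟫ (Vec.lookup (proj₂ c)) uv vu

identityCode : ∃ λ c → c ∈ˡ codes n
identityCode = (tabulate id , tabulate id) , ∈-codes (ok , ok)
  where ok : ∀ i → Vec.lookup (tabulate id) (Vec.lookup (tabulate id) i) ≡ i
        ok i = trans (lookup∘tabulate id _) (lookup∘tabulate id i)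

-- Two-sided translation: `c` becomes `π ∘ c ∘ ρ`, and its inverse table becomes `ρ⁻¹ ∘ c⁻¹ ∘ π⁻¹`.
-- The factors `π` and `ρ` are independent.
conjugate : Permutation′ n → Permutation′ n → Code n → Code n
conjugate π ρ (u , v) =
  tabulate (λ x → π ⟨$⟩ʳ Vec.lookup u (ρ ⟨$⟩ʳ x)) , tabulate (λ x → ρ ⟨$⟩ˡ Vec.lookup v (π ⟨$⟩ˡ x))

conjugate-lookup : ∀ π ρ (c : Code n) x → ⟪ conjugate π ρ c ⟫ x ≡ π ⟨$⟩ʳ ⟪ c ⟫ (ρ ⟨$⟩ʳ x)
conjugate-lookup π ρ c = lookup∘tabulate _

conjugate-injective : (π ρ : Permutation′ n) → Injective _≡_ _≡_ (conjugate π ρ)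
conjugate-injective π ρ {u , v} {u′ , v′} eq = cong₂ _,_
  (tabulate-injective′ λ x → begin
    Vec.lookup u x                                    ≡⟨ cong (Vec.lookup u) (sym (inverseʳ ρ)) ⟩
    Vec.lookup u (ρ ⟨$⟩ʳ (ρ ⟨$⟩ˡ x))                  ≡⟨ perm-injective π (tabulate-pointwise (cong proj₁ eq) _) ⟩
    Vec.lookup u′ (ρ ⟨$⟩ʳ (ρ ⟨$⟩ˡ x))                 ≡⟨ cong (Vec.lookup u′) (inverseʳ ρ) ⟩
    Vec.lookup u′ x                                   ∎)
  (tabulate-injective′ λ x → begin
    Vec.lookup v x                                    ≡⟨ cong (Vec.lookup v) (sym (inverseˡ π)) ⟩
    Vec.lookup v (π ⟨$⟩ˡ (π ⟨$⟩ʳ x))                  ≡⟨ perm-injective (flip ρ) (tabulate-pointwise (cong proj₂ eq) _) ⟩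
    Vec.lookup v′ (π ⟨$⟩ˡ (π ⟨$⟩ʳ x))                 ≡⟨ cong (Vec.lookup v′) (inverseˡ π) ⟩
    Vec.lookup v′ x                                   ∎)
  where
  open ≡-Reasoning
  tabulate-pointwise : ∀ {f g : Fin m → Fin n} → tabulate f ≡ tabulate g → ∀ x → f x ≡ g x
  tabulate-pointwise {f = f} {g} eq x = trans (sym (lookup∘tabulate f x)) (trans (cong (λ w → Vec.lookup w x) eq) (lookup∘tabulate g x))
  tabulate-injective′ : ∀ {w w′ : Vec (Fin n) m} → (∀ x → Vec.lookup w x ≡ Vec.lookup w′ x) → w ≡ w′
  tabulate-injective′ {w = w} {w′} h = trans (sym (tabulate∘lookup w)) (trans (tabulate-cong h) (tabulate∘lookup w′))
  perm-injective : (τ : Permutation′ n) → ∀ {x y} → τ ⟨$⟩ʳ x ≡ τ ⟨$⟩ʳ y → x ≡ y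
  perm-injective τ h = trans (sym (inverseˡ τ)) (trans (cong (τ ⟨$⟩ˡ_) h) (inverseˡ τ))

conjugate-∈ : ∀ π ρ {c : Code n} → c ∈ˡ codes n → conjugate π ρ c ∈ˡ codes n
conjugate-∈ π ρ {c} c∈ = ∈-codes
  ( (λ i → trans (lookup∘tabulate from _) (trans (cong from (lookup∘tabulate to i)) (inverseˡ τ)))
  , (λ i → trans (lookup∘tabulate to _) (trans (cong to (lookup∘tabulate from i)) (inverseʳ τ))) )
  where
  τ = ρ ∘ₚ toPermutation c∈ ∘ₚ π
  to from : Fin _ → Fin _
  to   x = π ⟨$⟩ʳ ⟪ c ⟫ (ρ ⟨$⟩ʳ x)
  from x = ρ ⟨$⟩ˡ Vec.lookup (proj₂ c) (π ⟨$⟩ˡ x)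

-- Flags and orders

-- Here `r` sends a point to its position in an order, so the preimage of a prefix is the set of the
-- first `k` points of that order.
Fits : List ℕ → SetOfSubsets n → (Fin n → Fin n) → Set
Fits {n} ks f r = All (λ k → f (preimage r (prefix n k)) ≡ true) ks

fits? : ∀ ks (f : SetOfSubsets n) r → Dec (Fits ks f r)
fits? ks f r = All.all? (λ k → f (preimage r (prefix _ k)) Bool.≟ true) ks

module _ {K : ℕ → Set} (v : FlagOfType n K) where

  private f = proj₁ v

  flag-< : ∀ {X} → f X ≡ true → ∣ X ∣ < n
  flag-< fX = proj₂ (proj₁ (proj₁ (proj₂ v)) _ fX)

  flag-chain : ∀ {X Y} → f X ≡ true → f Y ≡ true → X ⊆ Y ⊎ Y ⊆ X
  flag-chain = proj₂ (proj₁ (proj₂ v)) _ _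

  flag-type : ∀ {X} → f X ≡ true → K ∣ X ∣
  flag-type = proj₁ (proj₂ (proj₂ v)) _

  flag-member : ∀ {k} → K k → ∃ λ X → f X ≡ true × ∣ X ∣ ≡ k
  flag-member = proj₂ (proj₂ (proj₂ v)) _

  flag-unique : ∀ {X Y} → f X ≡ true → f Y ≡ true → ∣ X ∣ ≡ ∣ Y ∣ → X ≡ Y
  flag-unique fX fY eq with flag-chain fX fY
  ... | inj₁ X⊆Y = ⊆∧∣∣≡⇒≡ X⊆Y eq
  ... | inj₂ Y⊆X = sym (⊆∧∣∣≡⇒≡ Y⊆X (sym eq))

  straightenFlag : ∃ λ (σ : Permutation′ n) → ∀ {X} → f X ≡ true →
    preimage (σ ⟨$⟩ʳ_) (prefix n ∣ X ∣) ≡ X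
  straightenFlag = proj₁ straightened , λ fX → proj₂ straightened (∈-filter⁺ inFlag? (∈-subsets _) fX)
    where
    inFlag? : U.Decidable (λ X → f X ≡ true)
    inFlag? X = f X Bool.≟ true
    inFlag⁻ : ∀ {X} → X ∈ˡ filter inFlag? (subsets n) → f X ≡ true
    inFlag⁻ X∈ = proj₂ (∈-filter⁻ inFlag? {xs = subsets n} X∈)
    straightened = straighten (filter inFlag? (subsets n)) λ X∈ Y∈ → flag-chain (inFlag⁻ X∈) (inFlag⁻ Y∈)

∣preimage-prefix∣ : (π : Permutation′ n) {k : ℕ} → k ≤ n → ∣ preimage (π ⟨$⟩ʳ_) (prefix n k) ∣ ≡ k
∣preimage-prefix∣ {n} π {k} k≤n = trans (∣preimage∣ π (prefix n k)) (∣prefix∣ n k k≤n)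

module _ {K : ℕ → Set} {ks : List ℕ} (K⇒∈ : ∀ {k} → K k → k ∈ˡ ks) (∈⇒K : ∀ {k} → k ∈ˡ ks → K k) where

  -- A flag has only one member of each size, and the first `k` points already form one; hence a
  -- fitting order determines the whole flag.
  fits⇒≡ : (v : FlagOfType n K) (π : Permutation′ n) → Fits ks (proj₁ v) (π ⟨$⟩ʳ_) →
    ∀ {X} → proj₁ v X ≡ true → X ≡ preimage (π ⟨$⟩ʳ_) (prefix n ∣ X ∣)
  fits⇒≡ v π fits fX = flag-unique v fX (All.lookup fits (K⇒∈ (flag-type v fX)))
    (sym (∣preimage-prefix∣ π (<⇒≤ (flag-< v fX))))

  -- The symmetric group is transitive on flags: σ′ σ⁻¹ carries orders fitting v to orders fitting v′.
  fits-count-≤ : (v v′ : FlagOfType n K) (ψ : Permutation′ n) →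
    length (filter (λ c → fits? ks (proj₁ v) ⟪ c ⟫) (codes n)) ≤
    length (filter (λ c → fits? ks (proj₁ v′) ((ψ ⟨$⟩ʳ_) ∘ ⟪ c ⟫)) (codes n))
  fits-count-≤ {n} v v′ ψ with σ , σ-eq ← straightenFlag v | σ′ , σ′-eq ← straightenFlag v′ =
    filter-injection _ _ (codes-unique n) (conjugate (flip ψ) ρ) (conjugate-injective (flip ψ) ρ)
      λ c∈ fits → conjugate-∈ (flip ψ) ρ c∈ , All.tabulate λ k∈ → step c∈ fits k∈ (flag-member v′ (∈⇒K k∈))
    where
    ρ : Permutation′ n
    -- `_∘ₚ_` applies its left factor first, so `ρ` sends `x` to `σ⁻¹ (σ′ x)`, and pulling back
    -- along it takes a member of `v` to the member of `v′` of the same size. The other factor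
    -- `flip ψ` cancels the `ψ` of the target count.
    ρ = σ′ ∘ₚ flip σ
    step : ∀ {c k} (c∈ : c ∈ˡ codes n) → Fits ks (proj₁ v) ⟪ c ⟫ → k ∈ˡ ks →
      (∃ λ X → proj₁ v′ X ≡ true × ∣ X ∣ ≡ k) →
      proj₁ v′ (preimage (λ x → ψ ⟨$⟩ʳ ⟪ conjugate (flip ψ) ρ c ⟫ x) (prefix n k)) ≡ true
    step {c} c∈ fits k∈ (X , f′X , refl) = subst (λ Z → proj₁ v′ Z ≡ true) (sym eq) f′X
      where
      open ≡-Reasoning
      r = ⟪ c ⟫
      fr : proj₁ v (preimage r (prefix n ∣ X ∣)) ≡ true
      fr = All.lookup fits k∈
      ∣r∣≡∣X∣ : ∣ preimage r (prefix n ∣ X ∣) ∣ ≡ ∣ X ∣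
      ∣r∣≡∣X∣ = ∣preimage-prefix∣ (toPermutation c∈) (<⇒≤ (flag-< v′ f′X))
      eq : preimage (λ x → ψ ⟨$⟩ʳ ⟪ conjugate (flip ψ) ρ c ⟫ x) (prefix n ∣ X ∣) ≡ X
      eq = begin
        preimage (λ x → ψ ⟨$⟩ʳ ⟪ conjugate (flip ψ) ρ c ⟫ x) (prefix n ∣ X ∣)
          ≡⟨ preimage-cong (λ x → trans (cong (ψ ⟨$⟩ʳ_) (conjugate-lookup (flip ψ) ρ c x)) (inverseʳ ψ)) (prefix n ∣ X ∣) ⟩
        preimage (r ∘ (ρ ⟨$⟩ʳ_)) (prefix n ∣ X ∣)
          ≡⟨ sym (preimage-∘ (ρ ⟨$⟩ʳ_) r (prefix n ∣ X ∣)) ⟩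
        preimage (ρ ⟨$⟩ʳ_) (preimage r (prefix n ∣ X ∣))
          ≡⟨ cong (preimage (ρ ⟨$⟩ʳ_)) (sym (trans (cong (λ j → preimage (σ ⟨$⟩ʳ_) (prefix n j)) (sym ∣r∣≡∣X∣)) (σ-eq fr))) ⟩
        preimage (ρ ⟨$⟩ʳ_) (preimage (σ ⟨$⟩ʳ_) (prefix n ∣ X ∣))
          ≡⟨ preimage-∘ (ρ ⟨$⟩ʳ_) (σ ⟨$⟩ʳ_) (prefix n ∣ X ∣) ⟩
        preimage (λ x → σ ⟨$⟩ʳ (σ ⟨$⟩ˡ (σ′ ⟨$⟩ʳ x))) (prefix n ∣ X ∣)
          ≡⟨ preimage-cong (λ x → inverseʳ σ {σ′ ⟨$⟩ʳ x}) (prefix n ∣ X ∣) ⟩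
        preimage (σ′ ⟨$⟩ʳ_) (prefix n ∣ X ∣)
          ≡⟨ σ′-eq f′X ⟩
        X ∎

-- Rotations modulo n

[m+n%d]%d≡[m+n]%d : ∀ m n d .{{_ : NonZero d}} → (m + n % d) % d ≡ (m + n) % d
[m+n%d]%d≡[m+n]%d m n d = trans (%-distribˡ-+ m (n % d) d)
  (trans (cong (λ z → (m % d + z) % d) (m%n%n≡m%n n d)) (sym (%-distribˡ-+ m n d)))

[m%d+n]%d≡[m+n]%d : ∀ m n d .{{_ : NonZero d}} → (m % d + n) % d ≡ (m + n) % d
[m%d+n]%d≡[m+n]%d m n d = trans (cong (_% d) (+-comm (m % d) n))
  (trans ([m+n%d]%d≡[m+n]%d n m d) (cong (_% d) (+-comm n m)))

-- As `m + d < n + n`, reduction subtracts `n` at most once. The second case is stated additively to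
-- avoid truncated subtraction.
m<n⇒d≤n⇒[m+d]%n : ∀ {m n d} .{{_ : NonZero n}} → m < n → d ≤ n →
  (m + d) % n ≡ m + d ⊎ (m + d) % n + n ≡ m + d
m<n⇒d≤n⇒[m+d]%n {m} {n} {d} m<n d≤n with m + d <? n
... | yes h = inj₁ (m<n⇒m%n≡m h)
... | no ¬h = inj₂ (trans (cong (_+ n) (trans (cong (_% n) (sym e≡)) (trans ([m+n]%n≡m%n e n) (m<n⇒m%n≡m e<n)))) e≡)
  where
  e = m + d ∸ n
  e≡ : e + n ≡ m + d
  e≡ = m∸n+n≡m (≮⇒≥ ¬h)
  e<n : e < n
  e<n = +-cancelʳ-< n e n (subst (_< n + n) (sym e≡) (+-mono-<-≤ m<n d≤n))

module Rotation (n : ℕ) .{{_ : NonZero n}} where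

  shift : ℕ → Fin n → Fin n
  shift i q = fromℕ< (m%n<n (toℕ q + i) n)

  toℕ-shift : ∀ i q → toℕ (shift i q) ≡ (toℕ q + i) % n
  toℕ-shift i q = Fin.toℕ-fromℕ< _

  shift-shift : ∀ i j → i + j ≡ n → ∀ q → shift j (shift i q) ≡ q
  shift-shift i j eq q = Fin.toℕ-injective (begin
    toℕ (shift j (shift i q))     ≡⟨ toℕ-shift j _ ⟩
    (toℕ (shift i q) + j) % n     ≡⟨ cong (λ z → (z + j) % n) (toℕ-shift i q) ⟩
    ((toℕ q + i) % n + j) % n     ≡⟨ [m%d+n]%d≡[m+n]%d (toℕ q + i) j n ⟩
    (toℕ q + i + j) % n           ≡⟨ cong (_% n) (trans (+-assoc (toℕ q) i j) (cong (toℕ q +_) eq)) ⟩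
    (toℕ q + n) % n               ≡⟨ [m+n]%n≡m%n (toℕ q) n ⟩
    toℕ q % n                     ≡⟨ m<n⇒m%n≡m (Fin.toℕ<n q) ⟩
    toℕ q                         ∎)
    where open ≡-Reasoning

  rotation : Fin n → Permutation′ n
  rotation i = permutation (shift (toℕ i)) (shift (n ∸ toℕ i))
    (shift-shift (n ∸ toℕ i) (toℕ i) (m∸n+n≡m (Fin.toℕ≤n i)))
    (shift-shift (toℕ i) (n ∸ toℕ i) (m+[n∸m]≡n (Fin.toℕ≤n i)))

  -- The difference of two rotations is the same shift `d` at every position, so the distance
  -- between two rotations becomes the distance between the arcs they produce.
  rotation-+ : ∀ {i j d} → toℕ j ≡ (toℕ i + d) % n → ∀ q →
    toℕ (rotation j ⟨$⟩ʳ q) ≡ (toℕ (rotation i ⟨$⟩ʳ q) + d) % n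
  rotation-+ {i} {j} {d} j≡ q = begin
    toℕ (shift (toℕ j) q)              ≡⟨ toℕ-shift (toℕ j) q ⟩
    (toℕ q + toℕ j) % n                ≡⟨ cong (λ z → (toℕ q + z) % n) j≡ ⟩
    (toℕ q + (toℕ i + d) % n) % n      ≡⟨ [m+n%d]%d≡[m+n]%d (toℕ q) (toℕ i + d) n ⟩
    (toℕ q + (toℕ i + d)) % n          ≡⟨ cong (_% n) (sym (+-assoc (toℕ q) (toℕ i) d)) ⟩
    (toℕ q + toℕ i + d) % n            ≡⟨ sym ([m%d+n]%d≡[m+n]%d (toℕ q + toℕ i) d n) ⟩
    ((toℕ q + toℕ i) % n + d) % n      ≡⟨ cong (λ z → (z + d) % n) (sym (toℕ-shift (toℕ i) q)) ⟩
    (toℕ (shift (toℕ i) q) + d) % n    ∎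
    where open ≡-Reasoning

-- Katona's bound: the chosen arcs of length a on a circle of a + b points pairwise meet. Measured
-- from a fixed chosen arc, the others start at distances in (0 , a) or (b , a + b), and of two
-- distances differing by b at most one occurs.
module Katona (n a b : ℕ) .{{_ : NonZero n}} (n≡ : n ≡ a + b) (a<b : a < b) (0<a : 0 < a) where

  private instance
    b≢0 : NonZero b
    b≢0 = >-nonZero (<-trans 0<a a<b)

  katona : {A : Set ℓ} {ys : List A} → Unique ys → (I : A → Fin n) →
    (∀ {x y} → x ∈ˡ ys → y ∈ˡ ys → I x ≡ I y → x ≡ y) →
    (∀ {x y d} → x ∈ˡ ys → y ∈ˡ ys → a ≤ d → d ≤ b → toℕ (I y) ≢ (toℕ (I x) + d) % n) →
    length ys ≤ a
  katona {ys = []} _ _ _ _ = z≤n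
  katona {A = A} {ys = y₀ ∷ ys′} u I I-inj I-far =
    -- Reduction modulo `b` folds the distances above `b` into `[0 , a)`. Two different elements
    -- folded onto the same value would have starting points at distance `b`, against `I-far`.
    injectiveOn⇒length≤ u (λ y → dist y % b) a (λ y∈ → fold-< (fold y∈)) λ x∈ y∈ → fold-inj x∈ y∈ (fold x∈) (fold y∈)
    where
    open ≡-Reasoning
    ys = y₀ ∷ ys′
    i₀ = toℕ (I y₀)
    -- The clockwise distance from the first chosen start, with `n ∸ i₀` added in place of
    -- subtracting `i₀`.
    dist : A → ℕ
    dist y = (toℕ (I y) + (n ∸ i₀)) % n
    dist-spec : ∀ y → toℕ (I y) ≡ (i₀ + dist y) % n
    dist-spec y = sym (begin
      (i₀ + (toℕ (I y) + (n ∸ i₀)) % n) % n  ≡⟨ [m+n%d]%d≡[m+n]%d i₀ (toℕ (I y) + (n ∸ i₀)) n ⟩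
      (i₀ + (toℕ (I y) + (n ∸ i₀))) % n      ≡⟨ cong (_% n) (rearrange i₀ (toℕ (I y)) (n ∸ i₀)) ⟩
      (toℕ (I y) + (i₀ + (n ∸ i₀))) % n      ≡⟨ cong (λ z → (toℕ (I y) + z) % n) (m+[n∸m]≡n (Fin.toℕ≤n (I y₀))) ⟩
      (toℕ (I y) + n) % n                    ≡⟨ [m+n]%n≡m%n (toℕ (I y)) n ⟩
      toℕ (I y) % n                          ≡⟨ m<n⇒m%n≡m (Fin.toℕ<n (I y)) ⟩
      toℕ (I y)                              ∎)
      where
      rearrange : ∀ x y z → x + (y + z) ≡ y + (x + z)
      rearrange = solve-∀
    Folded : ℕ → Set
    Folded d = ∃ λ e → e < a × (d ≡ e ⊎ d ≡ e + b) × d % b ≡ e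
    fold : ∀ {y} → y ∈ˡ ys → Folded (dist y)
    fold {y} y∈ with dist y <? a | dist y ≤? b
    ... | yes d<a | _       = dist y , d<a , inj₁ refl , m<n⇒m%n≡m (<-trans d<a a<b)
    ... | no d≮a  | yes d≤b = contradiction (dist-spec y) (I-far (here refl) y∈ (≮⇒≥ d≮a) d≤b)
    ... | no d≮a  | no d≰b  = e , e<a , inj₂ (sym e+b) , (begin
      dist y % b   ≡⟨ cong (_% b) (sym e+b) ⟩
      (e + b) % b  ≡⟨ [m+n]%n≡m%n e b ⟩
      e % b        ≡⟨ m<n⇒m%n≡m (<-trans e<a a<b) ⟩
      e            ∎)
      where
      e = dist y ∸ b
      e+b : e + b ≡ dist y
      e+b = m∸n+n≡m (<⇒≤ (≰⇒> d≰b))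
      e<a : e < a
      e<a = +-cancelʳ-< b e a (subst₂ _<_ (sym e+b) n≡ (m%n<n (toℕ (I y) + (n ∸ i₀)) n))
    fold-< : ∀ {d} → Folded d → d % b < a
    fold-< (e , e<a , _ , refl) = e<a
    same : ∀ {x y} → x ∈ˡ ys → y ∈ˡ ys → dist x ≡ dist y → x ≡ y
    same {x} {y} x∈ y∈ eq = I-inj x∈ y∈ (Fin.toℕ-injective
      (trans (dist-spec x) (trans (cong (λ d → (i₀ + d) % n) eq) (sym (dist-spec y)))))
    far : ∀ {x y} → x ∈ˡ ys → y ∈ˡ ys → dist y ≢ dist x + b
    far {x} {y} x∈ y∈ eq = I-far x∈ y∈ (<⇒≤ a<b) ≤-refl (begin
      toℕ (I y)                    ≡⟨ dist-spec y ⟩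
      (i₀ + dist y) % n            ≡⟨ cong (_% n) (trans (cong (i₀ +_) eq) (sym (+-assoc i₀ (dist x) b))) ⟩
      (i₀ + dist x + b) % n        ≡⟨ sym ([m%d+n]%d≡[m+n]%d (i₀ + dist x) b n) ⟩
      ((i₀ + dist x) % n + b) % n  ≡⟨ cong (λ z → (z + b) % n) (sym (dist-spec x)) ⟩
      (toℕ (I x) + b) % n          ∎)
    fold-inj : ∀ {x y} → x ∈ˡ ys → y ∈ˡ ys → Folded (dist x) → Folded (dist y) →
      dist x % b ≡ dist y % b → x ≡ y
    fold-inj x∈ y∈ (e , _ , p , h) (e′ , _ , p′ , h′) eq with refl ← trans (sym h) (trans eq h′) | p | p′
    ... | inj₁ dx | inj₁ dy = same x∈ y∈ (trans dx (sym dy))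
    ... | inj₂ dx | inj₂ dy = same x∈ y∈ (trans dx (sym dy))
    ... | inj₁ dx | inj₂ dy = contradiction (trans dy (cong (_+ b) (sym dx))) (far x∈ y∈)
    ... | inj₂ dx | inj₁ dy = contradiction (trans dx (cong (_+ b) (sym dy))) (far y∈ x∈)

-- General position of arcs on a circle

GenPosSets-sym : {X Y : Subset n} → GenPosSets X Y → GenPosSets Y X
GenPosSets-sym {X = X} {Y} (inj₁ eq) = inj₁ (trans (Subset.∪-comm Y X) eq)
GenPosSets-sym {X = X} {Y} (inj₂ eq) = inj₂ (trans (Subset.∩-comm Y X) eq)

Adj-sym : {K : ℕ → Set} (v w : Vtx n K) → Adj v w → Adj w v
Adj-sym v w adj X Y wX vY = GenPosSets-sym (adj Y X vY wX)

-- A non-empty proper subset is not in general position with itself. This lets `¬Adj-lookup` cover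
-- two occurrences of one vertex along with two different vertices.
¬Adj-refl : {K : ℕ → Set} {k : ℕ} → K k → (v : Vtx n K) → ¬ Adj v v
¬Adj-refl {n = n} Kk v adj with X , vX , refl ← flag-member v Kk
                            with 0<X , X<n ← proj₁ (proj₁ (proj₂ v)) _ vX
                            with adj X X vX vX
... | inj₁ X∪X≡⊤ = <-irrefl (trans (cong ∣_∣ (trans (sym (Subset.∪-idem X)) X∪X≡⊤)) (Subset.∣⊤∣≡n n)) X<n
... | inj₂ X∩X≡⊥ = <-irrefl (sym (trans (cong ∣_∣ (trans (sym (Subset.∩-idem X)) X∩X≡⊥)) (Subset.∣⊥∣≡0 n))) 0<X

module Circle (n a b : ℕ) .{{_ : NonZero n}} (n≡ : n ≡ a + b) (a<b : a < b) (0<a : 0 < a)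
  {K : ℕ → Set} {ks : List ℕ} (K⇒∈ : ∀ {k} → K k → k ∈ˡ ks) (∈⇒K : ∀ {k} → k ∈ˡ ks → K k)
  (Kb : K b) (sizes : ∀ {k} → K k → k ≡ b ⊎ k + b ≤ a + a) where

  open Rotation n
  open Katona n a b n≡ a<b 0<a

  -- This is [0 , b) for k = b (where a ∸ k = 0) and [a − k , a) otherwise. The latter lies in every
  -- arc of length a inside [0 , b), because k + b ≤ a + a.
  arc : ℕ → Subset n
  arc k = window n (a ∸ k) k

  small⇒≤a : ∀ {k} → k + b ≤ a + a → k ≤ a
  small⇒≤a {k} k+b≤ = +-cancelʳ-≤ a k a (≤-trans (+-monoʳ-≤ k (<⇒≤ a<b)) k+b≤)

  a∸b≡0 : a ∸ b ≡ 0
  a∸b≡0 = m≤n⇒m∸n≡0 (<⇒≤ a<b)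

  ∈-arc-b⁺ : ∀ {p} → toℕ p < b → p ∈ arc b
  ∈-arc-b⁺ {p} p<b = ∈-window⁺ {s = a ∸ b} {b} (subst (_≤ toℕ p) (sym a∸b≡0) z≤n) (≤-trans p<b (m≤n+m b (a ∸ b)))

  ∈-arc-b⁻ : ∀ {p} → p ∈ arc b → toℕ p < b
  ∈-arc-b⁻ {p} p∈ = subst (λ z → toℕ p < z + b) a∸b≡0 (proj₂ (∈-window⁻ {s = a ∸ b} {b} p∈))

  ∈-arc⁺ : ∀ {k p} → k + b ≤ a + a → a ≤ toℕ p + k → toℕ p < a → p ∈ arc k
  ∈-arc⁺ {k} {p} small a≤p+k p<a = ∈-window⁺ {s = a ∸ k} {k} (m≤n+o⇒m∸n≤o a k (subst (a ≤_) (+-comm (toℕ p) k) a≤p+k))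
    (subst (toℕ p <_) (sym (m∸n+n≡m (small⇒≤a small))) p<a)

  ∈-arc⁻ : ∀ {k p} → k + b ≤ a + a → p ∈ arc k → a ≤ toℕ p + k × toℕ p < a
  ∈-arc⁻ {k} {p} small p∈ with lo , hi ← ∈-window⁻ {s = a ∸ k} {k} p∈ =
    subst (_≤ toℕ p + k) (m∸n+n≡m (small⇒≤a small)) (+-monoˡ-≤ k lo) , subst (toℕ p <_) (m∸n+n≡m (small⇒≤a small)) hi

  arc⊆arc-b : ∀ {k} → K k → arc k ⊆ arc b
  arc⊆arc-b Kk p∈ with sizes Kk
  ... | inj₁ refl  = p∈
  ... | inj₂ small = ∈-arc-b⁺ (<-trans (proj₂ (∈-arc⁻ small p∈)) a<b)

  arc-chain : ∀ {j k} → K j → K k → arc j ⊆ arc k ⊎ arc k ⊆ arc j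
  arc-chain {j} {k} Kj Kk with sizes Kj | sizes Kk
  ... | inj₁ refl | _         = inj₂ (arc⊆arc-b Kk)
  ... | inj₂ _    | inj₁ refl = inj₁ (arc⊆arc-b Kj)
  ... | inj₂ sj   | inj₂ sk   = Sum.map (mono sj sk) (mono sk sj) (≤-total j k)
    where
    mono : ∀ {j k} → j + b ≤ a + a → k + b ≤ a + a → j ≤ k → arc j ⊆ arc k
    mono sj sk j≤k p∈ with lo , hi ← ∈-arc⁻ sj p∈ = ∈-arc⁺ sk (≤-trans lo (+-monoʳ-≤ _ j≤k)) hi

  ∣arc∣ : ∀ {k} → K k → ∣ arc k ∣ ≡ k
  ∣arc∣ {k} Kk = ∣window∣ n (a ∸ k) k (subst (a ∸ k + k ≤_) (sym n≡) (fits (sizes Kk)))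
    where
    fits : k ≡ b ⊎ k + b ≤ a + a → a ∸ k + k ≤ a + b
    fits (inj₁ refl)  = +-monoˡ-≤ b (m∸n≤m a b)
    fits (inj₂ small) = subst (_≤ a + b) (sym (m∸n+n≡m (small⇒≤a small))) (m≤m+n a b)

  straightened : ∃ λ (ψ : Permutation′ n) → ∀ {X} → X ∈ˡ map arc ks → preimage (ψ ⟨$⟩ʳ_) (prefix n ∣ X ∣) ≡ X
  straightened = straighten (map arc ks) λ X∈ Y∈ → chain (∈-map⁻ arc X∈) (∈-map⁻ arc Y∈)
    where
    chain : ∀ {X Y} → (∃ λ j → j ∈ˡ ks × X ≡ arc j) → (∃ λ k → k ∈ˡ ks × Y ≡ arc k) → X ⊆ Y ⊎ Y ⊆ X
    chain (j , j∈ , refl) (k , k∈ , refl) = arc-chain (∈⇒K j∈) (∈⇒K k∈)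

  -- A renumbering of the positions that turns every `arc k` into a prefix, so that `Fits` along
  -- `turn i` tests the arcs rotated by `i`.
  ψ : Permutation′ n
  ψ = proj₁ straightened

  preimage-ψ : ∀ {k} → K k → preimage (ψ ⟨$⟩ʳ_) (prefix n k) ≡ arc k
  preimage-ψ {k} Kk = trans (cong (λ j → preimage (ψ ⟨$⟩ʳ_) (prefix n j)) (sym (∣arc∣ Kk)))
    (proj₂ straightened (∈-map⁺ arc (K⇒∈ Kk)))

  turn : Fin n → Permutation′ n
  turn i = rotation i ∘ₚ ψ

  fits⇒arc : (v : Vtx n K) (i : Fin n) (π : Permutation′ n) → Fits ks (proj₁ v) ((turn i ⟨$⟩ʳ_) ∘ (π ⟨$⟩ʳ_)) →
    ∀ {X} → proj₁ v X ≡ true → X ≡ preimage ((rotation i ⟨$⟩ʳ_) ∘ (π ⟨$⟩ʳ_)) (arc ∣ X ∣)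
  fits⇒arc v i π fits {X} vX = begin
    X
      ≡⟨ fits⇒≡ K⇒∈ ∈⇒K v (π ∘ₚ turn i) fits vX ⟩
    preimage ((turn i ⟨$⟩ʳ_) ∘ (π ⟨$⟩ʳ_)) (prefix n ∣ X ∣)
      ≡⟨ sym (preimage-∘ r (ψ ⟨$⟩ʳ_) (prefix n ∣ X ∣)) ⟩
    preimage r (preimage (ψ ⟨$⟩ʳ_) (prefix n ∣ X ∣))
      ≡⟨ cong (preimage r) (preimage-ψ (flag-type v vX)) ⟩
    preimage r (arc ∣ X ∣)
      ∎
    where
    open ≡-Reasoning
    r = (rotation i ⟨$⟩ʳ_) ∘ (π ⟨$⟩ʳ_)

  module _ {d : ℕ} (a≤d : a ≤ d) (d≤b : d ≤ b) where

    shifted : ∀ {p q : Fin n} → toℕ q ≡ (toℕ p + d) % n → toℕ q ≡ toℕ p + d ⊎ toℕ q + n ≡ toℕ p + d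
    shifted {p} q≡ = Sum.map (trans q≡) (trans (cong (_+ n) q≡))
      (m<n⇒d≤n⇒[m+d]%n (Fin.toℕ<n p) (≤-trans d≤b (subst (b ≤_) (sym n≡) (m≤n+m b a))))

    -- If `p` is at least `b`, then `d ≥ a` carries it past `n = a + b`, and `d ≤ b` makes it land
    -- below `b`. Equivalently, the complementary arcs of length `a` are disjoint.
    arcs-cover : ∀ {p q : Fin n} → toℕ q ≡ (toℕ p + d) % n → p ∈ arc b ⊎ q ∈ arc b
    arcs-cover {p} {q} q≡ with toℕ p <? b | shifted {p} {q} q≡
    ... | yes p<b | _         = inj₁ (∈-arc-b⁺ p<b)
    ... | no p≮b  | inj₁ q≡p+d = contradiction (Fin.toℕ<n q) (≤⇒≯ (begin
      n          ≡⟨ trans n≡ (+-comm a b) ⟩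
      b + a      ≤⟨ +-mono-≤ (≮⇒≥ p≮b) a≤d ⟩
      toℕ p + d  ≡⟨ sym q≡p+d ⟩
      toℕ q      ∎))
      where open ≤-Reasoning
    ... | no p≮b  | inj₂ q+n≡p+d = inj₂ (∈-arc-b⁺ (+-cancelʳ-< n (toℕ q) b (begin-strict
      toℕ q + n  ≡⟨ q+n≡p+d ⟩
      toℕ p + d  <⟨ +-mono-<-≤ (Fin.toℕ<n p) d≤b ⟩
      n + b      ≡⟨ +-comm n b ⟩
      b + n      ∎)))
      where open ≤-Reasoning

    -- From `a - k ≤ p < a` the shift by `d` does not wrap around, as `p + d < a + b`; it reaches at
    -- least `2a - k`, which is at least `b`.
    small-disjointˡ : ∀ {p q : Fin n} {k} → toℕ q ≡ (toℕ p + d) % n → k + b ≤ a + a → p ∈ arc k → ¬ q ∈ arc b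
    small-disjointˡ {p} {q} {k} q≡ small p∈ q∈ with a≤p+k , p<a ← ∈-arc⁻ small p∈ | q<b ← ∈-arc-b⁻ q∈
      | shifted {p} {q} q≡
    ... | inj₁ q≡p+d = <-irrefl refl (begin-strict
      a + a            ≤⟨ +-mono-≤ a≤p+k a≤d ⟩
      toℕ p + k + d    ≡⟨ rearrange (toℕ p) k d ⟩
      k + (toℕ p + d)  ≡⟨ cong (k +_) (sym q≡p+d) ⟩
      k + toℕ q        <⟨ +-monoʳ-< k q<b ⟩
      k + b            ≤⟨ small ⟩
      a + a            ∎)
      where
      open ≤-Reasoning
      rearrange : ∀ p k d → p + k + d ≡ k + (p + d)
      rearrange = solve-∀
    ... | inj₂ q+n≡p+d = <-irrefl refl (begin-strict
      toℕ p + d  <⟨ +-mono-<-≤ p<a d≤b ⟩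
      a + b      ≡⟨ sym n≡ ⟩
      n          ≤⟨ m≤n+m n (toℕ q) ⟩
      toℕ q + n  ≡⟨ q+n≡p+d ⟩
      toℕ p + d  ∎)
      where open ≤-Reasoning

    -- Without wrapping, `q ≥ d ≥ a` leaves the middle arc. With wrapping, `p = q + n - d` is at
    -- least `(a - k) + a`, hence at least `b`.
    small-disjointʳ : ∀ {p q : Fin n} {k} → toℕ q ≡ (toℕ p + d) % n → k + b ≤ a + a → p ∈ arc b → ¬ q ∈ arc k
    small-disjointʳ {p} {q} {k} q≡ small p∈ q∈ with p<b ← ∈-arc-b⁻ p∈ | a≤q+k , q<a ← ∈-arc⁻ small q∈
      | shifted {p} {q} q≡
    ... | inj₁ q≡p+d = <-irrefl refl (begin-strict
      a          ≤⟨ a≤d ⟩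
      d          ≤⟨ m≤n+m d (toℕ p) ⟩
      toℕ p + d  ≡⟨ sym q≡p+d ⟩
      toℕ q      <⟨ q<a ⟩
      a          ∎)
      where open ≤-Reasoning
    ... | inj₂ q+n≡p+d = <-irrefl refl (begin-strict
      a + (a + b)      ≡⟨ cong (a +_) (sym n≡) ⟩
      a + n            ≤⟨ +-monoˡ-≤ n a≤q+k ⟩
      toℕ q + k + n    ≡⟨ rearrange (toℕ q) k n ⟩
      toℕ q + n + k    ≡⟨ cong (_+ k) q+n≡p+d ⟩
      toℕ p + d + k    <⟨ +-monoˡ-< k (+-mono-<-≤ p<b d≤b) ⟩
      b + b + k        ≡⟨ trans (+-comm (b + b) k) (sym (+-assoc k b b)) ⟩
      k + b + b        ≤⟨ +-monoˡ-≤ b small ⟩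
      a + a + b        ≡⟨ +-assoc a a b ⟩
      a + (a + b)      ∎)
      where
      open ≤-Reasoning
      rearrange : ∀ q k n → q + k + n ≡ q + n + k
      rearrange = solve-∀

    -- Two arcs of length `b` cover the circle. In every other pair one arc is a middle arc, and it
    -- is disjoint even from the arc of length `b` around the other.
    arcs-genPos : ∀ {r s : Fin n → Fin n} → (∀ x → toℕ (s x) ≡ (toℕ (r x) + d) % n) →
      ∀ {j k} → K j → K k → GenPosSets (preimage r (arc j)) (preimage s (arc k))
    arcs-genPos {r} {s} s≡ {j} {k} Kj Kk with sizes Kj | sizes Kk
    ... | inj₁ refl  | inj₁ refl  = inj₁ (⊆-antisym Subset.⊆⊤ λ {x} _ → Subset.x∈p∪q⁺
            (Sum.map (∈-preimage⁺ {r = r} {arc b}) (∈-preimage⁺ {r = s} {arc b}) (arcs-cover (s≡ x))))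
    ... | inj₂ small | _          = inj₂ (Subset.Empty-unique λ (x , x∈) →
            let x∈j , x∈k = Subset.x∈p∩q⁻ (preimage r (arc j)) _ x∈ in
            small-disjointˡ (s≡ x) small (∈-preimage⁻ {r = r} {arc j} x∈j) (arc⊆arc-b Kk (∈-preimage⁻ {r = s} {arc k} x∈k)))
    ... | inj₁ refl  | inj₂ small = inj₂ (Subset.Empty-unique λ (x , x∈) →
            let x∈j , x∈k = Subset.x∈p∩q⁻ (preimage r (arc j)) _ x∈ in
            small-disjointʳ (s≡ x) small (∈-preimage⁻ {r = r} {arc j} x∈j) (∈-preimage⁻ {r = s} {arc k} x∈k))

  fits⇒Adj : (v w : Vtx n K) (i j : Fin n) (π : Permutation′ n) {d : ℕ} → a ≤ d → d ≤ b → toℕ j ≡ (toℕ i + d) % n →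
    Fits ks (proj₁ v) ((turn i ⟨$⟩ʳ_) ∘ (π ⟨$⟩ʳ_)) → Fits ks (proj₁ w) ((turn j ⟨$⟩ʳ_) ∘ (π ⟨$⟩ʳ_)) → Adj v w
  fits⇒Adj v w i j π a≤d d≤b j≡ fv fw X Y vX wY =
    subst₂ GenPosSets (sym (fits⇒arc v i π fv vX)) (sym (fits⇒arc w j π fw wY))
      (arcs-genPos a≤d d≤b (λ x → rotation-+ {i} {j} j≡ (π ⟨$⟩ʳ x)) (flag-type v vX) (flag-type w wY))

  fits⇒≈ : (v w : Vtx n K) (π : Permutation′ n) → Fits ks (proj₁ v) (π ⟨$⟩ʳ_) → Fits ks (proj₁ w) (π ⟨$⟩ʳ_) → v ≈V w
  fits⇒≈ v w π fv fw X = Bool.⇔→≡ (mk⇔ (imp v w fv fw) (imp w v fw fv))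
    where
    imp : (v w : Vtx n K) → Fits ks (proj₁ v) (π ⟨$⟩ʳ_) → Fits ks (proj₁ w) (π ⟨$⟩ʳ_) → proj₁ v X ≡ true → proj₁ w X ≡ true
    imp v w fv fw vX = subst (λ Z → proj₁ w Z ≡ true) (sym (fits⇒≡ K⇒∈ ∈⇒K v π fv vX)) (All.lookup fw (K⇒∈ (flag-type v vX)))

  module _ {vs : List (Vtx n K)} (independent : IsIndependent vs) where

    -- Vertices enter through their indices in `vs`: these have decidable equality, while vertices
    -- are compared by `_≈V_` only.
    Incident : Fin (length vs) × Fin n → Code n → Set
    Incident (u , i) c = Fits ks (proj₁ (lookup vs u)) ((turn i ⟨$⟩ʳ_) ∘ ⟪ c ⟫)

    incident? : ∀ y c → Dec (Incident y c)
    incident? (u , i) c = fits? ks (proj₁ (lookup vs u)) ((turn i ⟨$⟩ʳ_) ∘ ⟪ c ⟫)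

    positions : List (Fin (length vs) × Fin n)
    positions = cartesianProduct (allFin (length vs)) (allFin n)

    separated : ∀ {u w} → u ≢ w → ¬ (lookup vs u ≈V lookup vs w) × ¬ Adj (lookup vs u) (lookup vs w)
    separated = AllPairs-lookup
      (λ {v} {w} (v≉w , ¬adj) → (λ w≈v → v≉w (λ X → sym (w≈v X))) , λ adj → ¬adj (Adj-sym w v adj)) independent

    ¬Adj-lookup : ∀ u w → ¬ Adj (lookup vs u) (lookup vs w)
    ¬Adj-lookup u w with u Fin.≟ w
    ... | yes refl = ¬Adj-refl Kb (lookup vs u)
    ... | no u≢w   = proj₂ (separated u≢w)

    -- For a fixed order, vertices fitting at the same rotation coincide, since the rotated order
    -- determines its flag. Rotations at a distance between `a` and `b` would make their vertices
    -- adjacent. So `katona` bounds the rotations in use.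
    incidences-≤a : ∀ {c} → c ∈ˡ codes n → length (filter (λ y → incident? y c) positions) ≤ a
    incidences-≤a {c} c∈ = katona
      (Unique.filter⁺ _ (Unique.cartesianProduct⁺ (Unique.allFin⁺ (length vs)) (Unique.allFin⁺ n)))
      proj₂
      (λ x∈ y∈ → same (incident x∈) (incident y∈))
      λ {x} {y} x∈ y∈ a≤d d≤b eq → ¬Adj-lookup (proj₁ x) (proj₁ y)
        (fits⇒Adj (lookup vs (proj₁ x)) (lookup vs (proj₁ y)) _ _ (toPermutation c∈) a≤d d≤b eq (incident x∈) (incident y∈))
      where
      incident : ∀ {y} → y ∈ˡ filter (λ y → incident? y c) positions → Incident y c
      incident y∈ = proj₂ (∈-filter⁻ (λ y → incident? y c) {xs = positions} y∈)
      same : ∀ {x y} → Incident x c → Incident y c → proj₂ x ≡ proj₂ y → x ≡ y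
      same {u , i} {w , i} fu fw refl with u Fin.≟ w
      ... | yes refl = refl
      ... | no u≢w   = contradiction
        (fits⇒≈ (lookup vs u) (lookup vs w) (toPermutation c∈ ∘ₚ turn i) fu fw) (proj₁ (separated u≢w))

-- Flags below a fixed subset

length-cartesianProductWith : {A : Set ℓ₁} {B : Set ℓ₂} {D : Set ℓ₃} (f : A → B → D) → ∀ xs ys →
  length (cartesianProductWith f xs ys) ≡ length xs * length ys
length-cartesianProductWith f []       ys = refl
length-cartesianProductWith f (x ∷ xs) ys = trans (length-++ (map (f x) ys))
  (cong₂ _+_ (length-map (f x) ys) (length-cartesianProductWith f xs ys))

AllPairs-cartesianProductWith : {A : Set ℓ₁} {B : Set ℓ₂} {D : Set ℓ₃}
  {S : Rel A ℓ₁} {T : Rel B ℓ₂} {R : Rel D ℓ₃} (f : A → B → D) →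
  (∀ {x y y′} → T y y′ → R (f x y) (f x y′)) → (∀ {x x′ y y′} → S x x′ → R (f x y) (f x′ y′)) →
  ∀ {xs ys} → AllPairs S xs → AllPairs T ys → AllPairs R (cartesianProductWith f xs ys)
AllPairs-cartesianProductWith f same diff []       ts = []
AllPairs-cartesianProductWith {R = R} f same diff {x ∷ xs} {ys} (sx ∷ ss) ts =
  AllPairs.++⁺ (AllPairs.map⁺ (AllPairs.map same ts)) (AllPairs-cartesianProductWith f same diff ss ts)
    (All.map⁺ (All.tabulate λ {y} _ → others y sx))
  where
  others : ∀ y {xs} → All _ xs → All (R (f x y)) (cartesianProductWith f xs ys)
  others y []       = []
  others y (s ∷ ss) = All.++⁺ (All.map⁺ (All.tabulate λ _ → diff s)) (others y ss)

_≟ˢ_ : (X Y : Subset n) → Dec (X ≡ Y)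
_≟ˢ_ = Vec.≡-dec Bool._≟_

∩≡⊥⇒∣∣+∣∣≤n : (X Y : Subset n) → X ∩ Y ≡ ⊥ → ∣ X ∣ + ∣ Y ∣ ≤ n
∩≡⊥⇒∣∣+∣∣≤n {n} X Y X∩Y≡⊥ = begin
  ∣ X ∣ + ∣ Y ∣         ≤⟨ +-monoʳ-≤ ∣ X ∣ (Subset.p⊆q⇒∣p∣≤∣q∣ λ y∈Y → Subset.x∉p⇒x∈∁p λ y∈X →
                              ∉⊥ (subst (_ ∈_) X∩Y≡⊥ (Subset.x∈p∩q⁺ (y∈X , y∈Y)))) ⟩
  ∣ X ∣ + ∣ ∁ X ∣       ≡⟨ cong (∣ X ∣ +_) (Subset.∣∁p∣≡n∸∣p∣ X) ⟩
  ∣ X ∣ + (n ∸ ∣ X ∣)   ≡⟨ m+[n∸m]≡n (Subset.∣p∣≤n X) ⟩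
  n                     ∎
  where open ≤-Reasoning

-- A k-subset of Fin n, as the order embedding of Fin k onto it.
data Combination : ℕ → ℕ → Set where
  done : Combination 0 0
  keep : Combination n k → Combination (suc n) (suc k)
  skip : Combination n k → Combination (suc n) k

expand : Combination n k → Subset k → Subset n
expand done     []      = []
expand (keep B) (y ∷ Y) = y ∷ expand B Y
expand (skip B) Y       = false ∷ expand B Y

restrict : Combination n k → Subset n → Subset k
restrict done     []      = []
restrict (keep B) (x ∷ X) = x ∷ restrict B X
restrict (skip B) (x ∷ X) = restrict B X

carrier : Combination n k → Subset n
carrier B = expand B ⊤

restrict-expand : (B : Combination n k) (Y : Subset k) → restrict B (expand B Y) ≡ Y
restrict-expand done     []      = refl
restrict-expand (keep B) (y ∷ Y) = cong (y ∷_) (restrict-expand B Y)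
restrict-expand (skip B) Y       = restrict-expand B Y

expand-injective : (B : Combination n k) {Y Z : Subset k} → expand B Y ≡ expand B Z → Y ≡ Z
expand-injective B {Y} {Z} eq = trans (sym (restrict-expand B Y)) (trans (cong (restrict B) eq) (restrict-expand B Z))

expand-restrict : (B : Combination n k) {X : Subset n} → X ⊆ carrier B → expand B (restrict B X) ≡ X
expand-restrict done     {[]}        _   = refl
expand-restrict (keep B) {x ∷ X}     X⊆B = cong (x ∷_) (expand-restrict B (Subset.drop-∷-⊆ X⊆B))
expand-restrict (skip B) {false ∷ X} X⊆B = cong (false ∷_) (expand-restrict B (Subset.drop-∷-⊆ X⊆B))
expand-restrict (skip B) {true ∷ X}  X⊆B = contradiction (X⊆B Vec.here) λ ()

∣expand∣ : (B : Combination n k) (Y : Subset k) → ∣ expand B Y ∣ ≡ ∣ Y ∣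
∣expand∣ done     []          = refl
∣expand∣ (keep B) (true  ∷ Y) = cong suc (∣expand∣ B Y)
∣expand∣ (keep B) (false ∷ Y) = ∣expand∣ B Y
∣expand∣ (skip B) Y           = ∣expand∣ B Y

∣carrier∣ : (B : Combination n k) → ∣ carrier B ∣ ≡ k
∣carrier∣ {k = k} B = trans (∣expand∣ B ⊤) (Subset.∣⊤∣≡n k)

expand-mono : (B : Combination n k) {Y Z : Subset k} → Y ⊆ Z → expand B Y ⊆ expand B Z
expand-mono (keep B) {true ∷ Y} {true ∷ Z} Y⊆Z Vec.here = Vec.here
expand-mono (keep B) {true ∷ Y} {false ∷ Z} Y⊆Z Vec.here = contradiction (Y⊆Z Vec.here) λ ()
expand-mono (keep B) {_ ∷ Y} {_ ∷ Z} Y⊆Z (Vec.there p) = Vec.there (expand-mono B (Subset.drop-∷-⊆ Y⊆Z) p)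
expand-mono (skip B) Y⊆Z (Vec.there p) = Vec.there (expand-mono B Y⊆Z p)

restrict-mono : (B : Combination n k) {X Y : Subset n} → X ⊆ Y → restrict B X ⊆ restrict B Y
restrict-mono done X⊆Y {x = ()}
restrict-mono (keep B) {true ∷ X} {true ∷ Y} X⊆Y Vec.here = Vec.here
restrict-mono (keep B) {true ∷ X} {false ∷ Y} X⊆Y Vec.here = contradiction (X⊆Y Vec.here) λ ()
restrict-mono (keep B) {_ ∷ X} {_ ∷ Y} X⊆Y (Vec.there p) = Vec.there (restrict-mono B (Subset.drop-∷-⊆ X⊆Y) p)
restrict-mono (skip B) {_ ∷ X} {_ ∷ Y} X⊆Y p = restrict-mono B (Subset.drop-∷-⊆ X⊆Y) p

carrier-injective : (B B′ : Combination n k) → carrier B ≡ carrier B′ → B ≡ B′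
carrier-injective done     done      _  = refl
carrier-injective (keep B) (keep B′) eq = cong keep (carrier-injective B B′ (Vec.∷-injectiveʳ eq))
carrier-injective (skip B) (skip B′) eq = cong skip (carrier-injective B B′ (Vec.∷-injectiveʳ eq))
carrier-injective (keep B) (skip B′) eq = contradiction (Vec.∷-injectiveˡ eq) λ ()
carrier-injective (skip B) (keep B′) eq = contradiction (Vec.∷-injectiveˡ eq) λ ()

carrier-surjective : (X : Subset n) → ∣ X ∣ ≡ k → ∃ λ (B : Combination n k) → carrier B ≡ X
carrier-surjective []          refl = done , refl
carrier-surjective (true  ∷ X) refl = let B , eq = carrier-surjective X refl in keep B , cong (true ∷_) eq
carrier-surjective (false ∷ X) refl = let B , eq = carrier-surjective X refl in skip B , cong (false ∷_) eq

combinations : ∀ n k → List (Combination n k)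
combinations zero    zero    = done ∷ []
combinations zero    (suc k) = []
combinations (suc n) zero    = map skip (combinations n zero)
combinations (suc n) (suc k) = map keep (combinations n k) ++ map skip (combinations n (suc k))

∈-combinations : (B : Combination n k) → B ∈ˡ combinations n k
∈-combinations done                 = here refl
∈-combinations (keep B)             = ∈-++⁺ˡ (∈-map⁺ keep (∈-combinations B))
∈-combinations {k = zero}  (skip B) = ∈-map⁺ skip (∈-combinations B)
∈-combinations {k = suc k} (skip B) = ∈-++⁺ʳ (map keep (combinations _ k)) (∈-map⁺ skip (∈-combinations B))

length-combinations : ∀ n k → length (combinations n k) ≡ n C k
length-combinations zero    zero    = refl
length-combinations zero    (suc k) = refl
length-combinations (suc n) zero    = trans (length-map skip (combinations n zero)) (length-combinations n zero)
length-combinations (suc n) (suc k) = begin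
  length (map keep (combinations n k) ++ map skip (combinations n (suc k)))
    ≡⟨ length-++ (map keep (combinations n k)) ⟩
  length (map keep (combinations n k)) + length (map skip (combinations n (suc k)))
    ≡⟨ cong₂ _+_ (trans (length-map keep (combinations n k)) (length-combinations n k))
                 (trans (length-map skip (combinations n (suc k))) (length-combinations n (suc k))) ⟩
  n C k + n C suc k
    ≡⟨ nCk+nC[k+1]≡[n+1]C[k+1] n k ⟩
  suc n C suc k ∎
  where open ≡-Reasoning

combinations-unique : ∀ n k → Unique (combinations n k)
combinations-unique zero    zero    = [] ∷ []
combinations-unique zero    (suc k) = []
combinations-unique (suc n) zero    = Unique.map⁺ (λ { refl → refl }) (combinations-unique n zero)
combinations-unique (suc n) (suc k) = Unique.++⁺
  (Unique.map⁺ (λ { refl → refl }) (combinations-unique n k))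
  (Unique.map⁺ (λ { refl → refl }) (combinations-unique n (suc k)))
  λ (p , q) → disjoint (∈-map⁻ keep p) (∈-map⁻ skip q)
  where
  disjoint : ∀ {B} → (∃ λ D → D ∈ˡ combinations n k × B ≡ keep D) → ¬ (∃ λ D → D ∈ˡ combinations n (suc k) × B ≡ skip D)
  disjoint (_ , _ , refl) (_ , _ , ())

-- The flag `g` transported into the carrier of `B`, together with the carrier itself as
-- `expand B ⊤`. The first test says that `X` lies inside the carrier, since `restrict` forgets the
-- points outside.
extend : Combination n k → SetOfSubsets k → SetOfSubsets n
extend B g X = does (X ≟ˢ expand B (restrict B X)) ∧ (g (restrict B X) ∨ does (restrict B X ≟ˢ ⊤))

module _ (B : Combination n k) (g : SetOfSubsets k) where

  extend⁺ : ∀ {Y} → g Y ≡ true ⊎ Y ≡ ⊤ → extend B g (expand B Y) ≡ true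
  extend⁺ {Y} h rewrite restrict-expand B Y | dec-true (expand B Y ≟ˢ expand B Y) refl with h
  ... | inj₁ gY rewrite gY = refl
  ... | inj₂ Y≡⊤ = trans (cong (g Y ∨_) (dec-true (Y ≟ˢ ⊤) Y≡⊤)) (Bool.∨-zeroʳ (g Y))

  extend⁻ : ∀ {X} → extend B g X ≡ true → ∃ λ Y → X ≡ expand B Y × (g Y ≡ true ⊎ Y ≡ ⊤)
  extend⁻ {X} h with X ≟ˢ expand B (restrict B X) | g (restrict B X) in gY | restrict B X ≟ˢ ⊤
  ... | yes X≡ | true  | _      = restrict B X , X≡ , inj₁ gY
  ... | yes X≡ | false | yes Y≡ = restrict B X , X≡ , inj₂ Y≡
  extend⁻ () | yes X≡ | false | no _
  extend⁻ () | no _ | _ | _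

module _ {Ty : ℕ → Set} (0<k : 0 < k) (k<n : k < n) where

  extendFlag : Combination n k → Vtx k Ty → Vtx n (Ty ∪｛ k ｝)
  extendFlag B w = extend B g , (proper , chain) , (λ X → types) , members
    where
    g = proj₁ w
    ∣⊤∣≡k = Subset.∣⊤∣≡n k
    proper : ∀ X → extend B g X ≡ true → (0 < ∣ X ∣) × (∣ X ∣ < n)
    proper X fX with extend⁻ B g fX
    ... | Y , refl , inj₁ gY   rewrite ∣expand∣ B Y = proj₁ (proj₁ (proj₁ (proj₂ w)) Y gY) , <-trans (flag-< w gY) k<n
    ... | _ , refl , inj₂ refl rewrite ∣carrier∣ B = 0<k , k<n
    chain : ∀ X Y → extend B g X ≡ true → extend B g Y ≡ true → X ⊆ Y ⊎ Y ⊆ X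
    chain X Y fX fY with extend⁻ B g fX | extend⁻ B g fY
    ... | _ , refl , inj₁ gX   | _ , refl , inj₁ gY   = Sum.map (expand-mono B) (expand-mono B) (flag-chain w gX gY)
    ... | _ , refl , inj₂ refl | _ , refl , _         = inj₂ (expand-mono B Subset.⊆⊤)
    ... | _ , refl , _         | _ , refl , inj₂ refl = inj₁ (expand-mono B Subset.⊆⊤)
    types : ∀ {X} → extend B g X ≡ true → (Ty ∪｛ k ｝) ∣ X ∣
    types fX with extend⁻ B g fX
    ... | Y , refl , inj₁ gY   = inj₁ (subst Ty (sym (∣expand∣ B Y)) (flag-type w gY))
    ... | _ , refl , inj₂ refl = inj₂ (∣carrier∣ B)
    members : ∀ j → (Ty ∪｛ k ｝) j → ∃ λ X → (extend B g X ≡ true) × (∣ X ∣ ≡ j)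
    members j (inj₁ Tj)   = let Y , gY , eq = flag-member w Tj in
      expand B Y , extend⁺ B g (inj₁ gY) , trans (∣expand∣ B Y) eq
    members j (inj₂ refl) = carrier B , extend⁺ B g (inj₂ refl) , ∣carrier∣ B

  private
    ∈-extend⇒∈ : (B : Combination n k) (w : Vtx k Ty) {Y : Subset k} → ∣ Y ∣ < k →
      extend B (proj₁ w) (expand B Y) ≡ true → proj₁ w Y ≡ true
    ∈-extend⇒∈ B w ∣Y∣<k fY with extend⁻ B (proj₁ w) fY
    ... | Z , Y≡Z , h with refl ← expand-injective B Y≡Z | h
    ... | inj₁ wY   = wY
    ... | inj₂ refl = contradiction ∣Y∣<k (<-irrefl (Subset.∣⊤∣≡n k))

  -- The carrier is the only member of size `k`, as all members coming from `w′` are smaller; so the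
  -- extended flag recovers `B`.
  extendFlag-≈⇒≡ : (B B′ : Combination n k) (w w′ : Vtx k Ty) → extendFlag B w ≈V extendFlag B′ w′ → B ≡ B′
  extendFlag-≈⇒≡ B B′ w w′ eq
    with extend⁻ B′ (proj₁ w′) (trans (sym (eq (carrier B))) (extend⁺ B (proj₁ w) (inj₂ refl)))
  ... | Y , B≡Y , inj₂ refl = carrier-injective B B′ B≡Y
  ... | Y , B≡Y , inj₁ w′Y  = contradiction (flag-< w′ w′Y)
          (<-irrefl (trans (sym (∣expand∣ B′ Y)) (trans (cong ∣_∣ (sym B≡Y)) (∣carrier∣ B))))

  extendFlag-reflects-≈ : (B : Combination n k) (w w′ : Vtx k Ty) → extendFlag B w ≈V extendFlag B w′ → w ≈V w′
  extendFlag-reflects-≈ B w w′ eq Y = Bool.⇔→≡ (mk⇔ (imp w w′ eq) (imp w′ w (sym ∘ eq)))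
    where
    imp : ∀ w w′ → extendFlag B w ≈V extendFlag B w′ → proj₁ w Y ≡ true → proj₁ w′ Y ≡ true
    imp w w′ eq wY = ∈-extend⇒∈ B w′ (flag-< w wY) (trans (sym (eq (expand B Y))) (extend⁺ B (proj₁ w) (inj₁ wY)))

  -- The carriers alone obstruct: their union misses `x`, and two sets of size `k` cannot be
  -- disjoint when `n < k + k`.
  extendFlag-¬Adj : n < k + k → (B B′ : Combination n k) (w w′ : Vtx k Ty) {x : Fin n} →
    ¬ x ∈ carrier B → ¬ x ∈ carrier B′ → ¬ Adj (extendFlag B w) (extendFlag B′ w′)
  extendFlag-¬Adj n<k+k B B′ w w′ x∉B x∉B′ adj
    with adj (carrier B) (carrier B′) (extend⁺ B (proj₁ w) (inj₂ refl)) (extend⁺ B′ (proj₁ w′) (inj₂ refl))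
  ... | inj₁ ∪≡⊤ = Sum.[ x∉B , x∉B′ ] (Subset.x∈p∪q⁻ (carrier B) _ (subst (_ ∈_) (sym ∪≡⊤) Subset.∈⊤))
  ... | inj₂ ∩≡⊥ = <⇒≱ n<k+k (subst₂ (λ i j → i + j ≤ n) (∣carrier∣ B) (∣carrier∣ B′)
          (∩≡⊥⇒∣∣+∣∣≤n (carrier B) (carrier B′) ∩≡⊥))

-- The two bounds

module Bounds (n a b : ℕ) .{{_ : NonZero n}} (n≡ : n ≡ a + b) (a<b : a < b) (0<a : 0 < a)
  {Ty : ℕ → Set} {tl : List ℕ} (Ty⇒∈ : ∀ {k} → Ty k → k ∈ˡ tl) (∈⇒Ty : ∀ {k} → k ∈ˡ tl → Ty k)
  (positive : ∀ {k} → Ty k → 0 < k) (small : ∀ {k} → Ty k → k + b ≤ a + a)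
  (ws : List (Vtx b Ty)) where

  private
    K : ℕ → Set
    K = Ty ∪｛ b ｝

    0<b : 0 < b
    0<b = <-trans 0<a a<b

    b<n : b < n
    b<n = subst (b <_) (sym n≡) (+-monoˡ-< b 0<a)

    n<b+b : n < b + b
    n<b+b = subst (_< b + b) (sym n≡) (+-monoˡ-< b a<b)

    Ty⇒<b : ∀ {k} → Ty k → k < b
    Ty⇒<b {k} Tk = +-cancelʳ-< b k b (≤-<-trans (small Tk) (+-mono-< a<b a<b))

    ks : List ℕ
    ks = b ∷ tl

    K⇒∈ : ∀ {k} → K k → k ∈ˡ ks
    K⇒∈ (inj₁ Tk)   = there (Ty⇒∈ Tk)
    K⇒∈ (inj₂ refl) = here refl

    ∈⇒K : ∀ {k} → k ∈ˡ ks → K k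
    ∈⇒K (here refl) = inj₂ refl
    ∈⇒K (there k∈)  = inj₁ (∈⇒Ty k∈)

    sizes : ∀ {k} → K k → k ≡ b ⊎ k + b ≤ a + a
    sizes (inj₁ Tk) = inj₂ (small Tk)
    sizes (inj₂ eq) = inj₁ eq

  open Circle n a b n≡ a<b 0<a K⇒∈ ∈⇒K (inj₂ refl) sizes

  module _ (complete : ∀ v → Any (v ≈V_) ws) where

    allFlags : List (Vtx n K)
    allFlags = cartesianProductWith (extendFlag 0<b b<n) (combinations n b) ws

    -- The flag is read off the order: its first `b` points form the carrier of `B`, and its first
    -- `j` points, for `j` in `tl`, are restricted to `B` to give a flag of type `Ty`.
    allFlags-fit : (π : Permutation′ n) → ∃ λ v → v ∈ˡ allFlags × Fits ks (proj₁ v) (π ⟨$⟩ʳ_)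
    allFlags-fit π = extendFlag 0<b b<n B w ,
      ∈-cartesianProductWith⁺ (extendFlag 0<b b<n) (∈-combinations B) w∈ , b-fits ∷ All.tabulate tl-fits
      where
      P : ℕ → Subset n
      P j = preimage (π ⟨$⟩ʳ_) (prefix n j)
      ∣P∣ : ∀ {j} → j ≤ b → ∣ P j ∣ ≡ j
      ∣P∣ j≤b = ∣preimage-prefix∣ π (≤-trans j≤b (<⇒≤ b<n))
      P-mono : ∀ {i j} → i ≤ j → P i ⊆ P j
      P-mono {i} {j} i≤j = preimage-mono (π ⟨$⟩ʳ_) {prefix n i} {prefix n j} (prefix-mono {j = i} {j} i≤j)
      chosen : ∃ λ (B : Combination n b) → carrier B ≡ P b
      chosen = carrier-surjective (P b) (∣P∣ ≤-refl)
      B = proj₁ chosen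
      Listed : Subset b → ℕ → Set
      Listed Y j = expand B Y ≡ P j
      listed? : ∀ Y → Dec (Any (Listed Y) tl)
      listed? Y = Any.any? (λ j → expand B Y ≟ˢ P j) tl
      g : SetOfSubsets b
      g Y = does (listed? Y)
      g⁻ : ∀ {Y} → g Y ≡ true → ∃ λ j → Ty j × expand B Y ≡ P j × ∣ Y ∣ ≡ j
      g⁻ {Y} gY with listed? Y
      ... | yes any with j , j∈ , eq ← find any =
        j , ∈⇒Ty j∈ , eq , trans (sym (∣expand∣ B Y)) (trans (cong ∣_∣ eq) (∣P∣ (<⇒≤ (Ty⇒<b (∈⇒Ty j∈)))))
      g⁺ : ∀ {j} → Ty j → ∃ λ Y → g Y ≡ true × expand B Y ≡ P j
      g⁺ {j} Tj = Y , dec-true (listed? Y) (lose (Ty⇒∈ Tj) eq) , eq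
        where
        Y = restrict B (P j)
        eq : expand B Y ≡ P j
        eq = expand-restrict B (subst (P j ⊆_) (sym (proj₂ chosen)) (P-mono (<⇒≤ (Ty⇒<b Tj))))
      P-reflects-⊆ : ∀ {Y Z i j} → expand B Y ≡ P i → expand B Z ≡ P j → i ≤ j → Y ⊆ Z
      P-reflects-⊆ {Y} {Z} {i} {j} Y≡ Z≡ i≤j = subst₂ _⊆_
        (trans (cong (restrict B) (sym Y≡)) (restrict-expand B Y))
        (trans (cong (restrict B) (sym Z≡)) (restrict-expand B Z))
        (restrict-mono B (P-mono i≤j))
      restricted : Vtx b Ty
      restricted = g , (proper , chain) , types , members
        where
        proper : ∀ Y → g Y ≡ true → (0 < ∣ Y ∣) × (∣ Y ∣ < b)
        proper Y gY with j , Tj , _ , refl ← g⁻ gY = positive Tj , Ty⇒<b Tj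
        chain : ∀ Y Z → g Y ≡ true → g Z ≡ true → Y ⊆ Z ⊎ Z ⊆ Y
        chain Y Z gY gZ with i , _ , Y≡ , _ ← g⁻ gY | j , _ , Z≡ , _ ← g⁻ gZ =
          Sum.map (P-reflects-⊆ Y≡ Z≡) (P-reflects-⊆ Z≡ Y≡) (≤-total i j)
        types : ∀ Y → g Y ≡ true → Ty ∣ Y ∣
        types Y gY with j , Tj , _ , refl ← g⁻ gY = Tj
        members : ∀ j → Ty j → ∃ λ Y → (g Y ≡ true) × (∣ Y ∣ ≡ j)
        members j Tj with Y , gY , eq ← g⁺ Tj =
          Y , gY , trans (sym (∣expand∣ B Y)) (trans (cong ∣_∣ eq) (∣P∣ (<⇒≤ (Ty⇒<b Tj))))
      -- The list `ws` contains each flag up to `_≈V_` only, so the flag just built is exchanged for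
      -- its representative.
      represented : ∃ λ w → w ∈ˡ ws × restricted ≈V w
      represented = find (complete restricted)
      w = proj₁ represented
      w∈ = proj₁ (proj₂ represented)
      b-fits : proj₁ (extendFlag 0<b b<n B w) (P b) ≡ true
      b-fits = subst (λ X → extend B (proj₁ w) X ≡ true) (proj₂ chosen) (extend⁺ B (proj₁ w) (inj₂ refl))
      tl-fits : ∀ {j} → j ∈ˡ tl → proj₁ (extendFlag 0<b b<n B w) (P j) ≡ true
      tl-fits {j} j∈ = listed-fits (g⁺ (∈⇒Ty j∈))
        where
        listed-fits : (∃ λ Y → g Y ≡ true × expand B Y ≡ P j) → proj₁ (extendFlag 0<b b<n B w) (P j) ≡ true
        listed-fits (Y , gY , eq) = subst (λ X → extend B (proj₁ w) X ≡ true) eq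
          (extend⁺ B (proj₁ w) (inj₁ (trans (sym (proj₂ (proj₂ represented) Y)) gY)))

    -- Let `s` be the number of orders fitting the first vertex. Each pair of a vertex and a
    -- rotation fits at least `s` orders and each order at most `a` pairs; each order fits a flag in
    -- `allFlags` and each flag at most `s` orders. The number of orders is thus squeezed between
    -- the two counts, and `s` cancels.
    independent-≤ : (vs : List (Vtx n K)) → IsIndependent vs → n * length vs ≤ a * (n C b) * length ws
    independent-≤ []          _           = subst (_≤ a * (n C b) * length ws) (sym (*-zeroʳ n)) z≤n
    independent-≤ vs@(v₀ ∷ _) independent = *-cancelˡ-≤ s {{>-nonZero 0<s}} (begin
      s * (n * length vs)               ≡⟨ reorder₁ n s (length vs) ⟩
      length vs * n * s                 ≡⟨ cong (_* s) (sym length-positions) ⟩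
      length xs * s                     ≤⟨ doubleCounting (incident? independent) xs (codes n)
                                             (λ {x} _ → fits-count-≤ K⇒∈ ∈⇒K v₀ (lookup vs (proj₁ x)) (turn (proj₂ x)))
                                             (incidences-≤a independent) ⟩
      length (codes n) * a              ≤⟨ *-monoˡ-≤ a codes-≤ ⟩
      length allFlags * s * a           ≡⟨ cong (λ z → z * s * a) length-allFlags ⟩
      (n C b) * c * s * a               ≡⟨ reorder₂ (n C b) c s a ⟩
      s * (a * (n C b) * c)             ∎)
      where
      open ≤-Reasoning
      c = length ws
      xs = positions independent
      s = length (filter (λ c → fits? ks (proj₁ v₀) ⟪ c ⟫) (codes n))
      length-allFlags : length allFlags ≡ (n C b) * c
      length-allFlags = trans (length-cartesianProductWith _ (combinations n b) ws)
        (cong (_* length ws) (length-combinations n b))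
      length-positions : length xs ≡ length vs * n
      length-positions = trans (length-cartesianProductWith _,_ (allFin (length vs)) (allFin n))
        (cong₂ _*_ (length-tabulate {n = length vs} id) (length-tabulate {n = n} id))
      codes-≤ : length (codes n) ≤ length allFlags * s
      codes-≤ = subst (_≤ length allFlags * s) (*-identityʳ (length (codes n)))
        (doubleCounting (λ c v → fits? ks (proj₁ v) ⟪ c ⟫) (codes n) allFlags
          (λ {c} c∈ → let v , v∈ , fits = allFlags-fit (toPermutation c∈) in
            filter-some (λ v → fits? ks (proj₁ v) ⟪ c ⟫) (lose v∈ fits))
          (λ {v} _ → fits-count-≤ K⇒∈ ∈⇒K v v₀ Perm.id))
      -- If `s` were 0, then `codes-≤` would leave no orders at all, but the identity is one.
      0<s : 0 < s
      0<s = n≢0⇒n>0 λ s≡0 → <⇒≱ (∈-length (proj₂ (identityCode {n})))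
        (subst (length (codes n) ≤_) (trans (cong (length allFlags *_) s≡0) (*-zeroʳ (length allFlags))) codes-≤)
      reorder₁ : ∀ n s m → s * (n * m) ≡ m * n * s
      reorder₁ = solve-∀
      reorder₂ : ∀ x c s a → x * c * s * a ≡ s * (a * x * c)
      reorder₂ = solve-∀

-- The lower bound: flags avoiding a point

module _ {n b : ℕ} (0<b : 0 < b) (b<1+n : b < suc n) (1+n<b+b : suc n < b + b) {Ty : ℕ → Set} where

  -- The flags whose member of size b misses the point 0.
  star : List (Vtx b Ty) → List (Vtx (suc n) (Ty ∪｛ b ｝))
  star ws = cartesianProductWith (λ B → extendFlag 0<b b<1+n (skip B)) (combinations n b) ws

  star-independent : ∀ {ws} → AllPairs (λ u v → ¬ (u ≈V v)) ws → IsIndependent (star ws)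
  star-independent distinct = AllPairs-cartesianProductWith {S = _≢_} {T = λ u v → ¬ (u ≈V v)}
    {R = λ u v → ¬ (u ≈V v) × ¬ Adj u v} _
    (λ {B} {w} {w′} w≉w′ → (w≉w′ ∘ extendFlag-reflects-≈ 0<b b<1+n (skip B) w w′) , ¬adj B B w w′)
    (λ {B} {B′} {w} {w′} B≢B′ →
      (λ eq → B≢B′ (skip-injective (extendFlag-≈⇒≡ 0<b b<1+n (skip B) (skip B′) w w′ eq))) , ¬adj B B′ w w′)
    (combinations-unique n b) distinct
    where
    skip-injective : ∀ {B B′ : Combination n b} → skip B ≡ skip B′ → B ≡ B′
    skip-injective refl = refl
    0∉ : (B : Combination n b) → ¬ zero ∈ carrier (skip B)
    0∉ B ()
    ¬adj : ∀ B B′ w w′ → ¬ Adj (extendFlag 0<b b<1+n (skip B) w) (extendFlag 0<b b<1+n (skip B′) w′)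
    ¬adj B B′ w w′ = extendFlag-¬Adj 0<b b<1+n 1+n<b+b (skip B) (skip B′) w w′ (0∉ B) (0∉ B′)

  length-star : ∀ ws → length (star ws) ≡ (n C b) * length ws
  length-star ws = trans (length-cartesianProductWith _ (combinations n b) ws)
    (cong (_* length ws) (length-combinations n b))

mainTheorem1 : (b n : ℕ) → 0 < b → 0 < n → (T : Subset n) →
    (∃ λ (i : Fin n) → i ∈ T) →
    (∀ (i : Fin n) → i ∈ T → suc (toℕ i) + 3 * b ≤ 2 * n) →
    2 * n < 4 * b →
    ∀ (c : ℕ) → NumVertices b ⟦ T ⟧ c →
    IndependenceNumber n (⟦ T ⟧ ∪｛ b ｝) (((n ∸ 1) C b) * c)
mainTheorem1 b n@(suc n′) 0<b _ T (i₀ , i₀∈T) max-small 2n<4b c (ws , distinct , complete , refl) =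
  (star 0<b b<n n<b+b ws , star-independent 0<b b<n n<b+b distinct , length-star 0<b b<n n<b+b ws) ,
  λ vs independent → *-cancelˡ-≤ n (begin
    n * length vs                   ≤⟨ independent-≤ complete vs independent ⟩
    a * (n C b) * length ws         ≡⟨ cong (_* length ws) ([n-k]*nCk≡n*[n-1]Ck n′ a b n≡) ⟩
    n * (n′ C b) * length ws        ≡⟨ *-assoc n (n′ C b) (length ws) ⟩
    n * ((n′ C b) * length ws)      ∎)
  where
  open ≤-Reasoning
  a = n ∸ b
  sizes : List ℕ
  sizes = map (suc ∘ toℕ) (filter (_∈? T) (allFin n))
  T⇒∈ : ∀ {k} → ⟦ T ⟧ k → k ∈ˡ sizes
  T⇒∈ (i , i∈T , refl) = ∈-map⁺ (suc ∘ toℕ) (∈-filter⁺ (_∈? T) (∈-allFin i) i∈T)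
  ∈⇒T : ∀ {k} → k ∈ˡ sizes → ⟦ T ⟧ k
  ∈⇒T k∈ = let i , i∈ , eq = ∈-map⁻ (suc ∘ toℕ) k∈ in
    i , proj₂ (∈-filter⁻ (_∈? T) {xs = allFin n} i∈) , sym eq
  -- An element `t` of `T` gives `2b ≤ 3b < t + 3b ≤ 2n`.
  b<n : b < n
  b<n = *-cancelˡ-< 2 b n (<-≤-trans (≤-<-trans (*-monoˡ-≤ b {2} {3} (s≤s (s≤s z≤n))) (m<n+m (3 * b) {suc (toℕ i₀)} (s≤s z≤n)))
    (max-small i₀ i₀∈T))
  n≡ : n ≡ a + b
  n≡ = sym (m∸n+n≡m (<⇒≤ b<n))
  a<b : a < b
  a<b = +-cancelʳ-< b a b (subst (_< b + b) n≡ (*-cancelˡ-< 2 n (b + b) (subst (2 * n <_) (double b) 2n<4b)))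
    where
    double : ∀ b → 4 * b ≡ 2 * (b + b)
    double = solve-∀
  n<b+b : n < b + b
  n<b+b = subst (_< b + b) (sym n≡) (+-monoˡ-< b a<b)
  -- With `n = a + b`, the hypothesis on `T` reads `k + 3b ≤ 2a + 2b`, and `2b` cancels.
  small : ∀ {k} → ⟦ T ⟧ k → k + b ≤ a + a
  small {k} (i , i∈T , refl) = +-cancelʳ-≤ (2 * b) (k + b) (a + a)
    (subst₂ _≤_ (regroup k b) (trans (cong (2 *_) n≡) (regroup′ a b)) (max-small i i∈T))
    where
    regroup : ∀ k b → k + 3 * b ≡ k + b + 2 * b
    regroup = solve-∀
    regroup′ : ∀ a b → 2 * (a + b) ≡ a + a + 2 * b
    regroup′ = solve-∀
  positive : ∀ {k} → ⟦ T ⟧ k → 0 < k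
  positive (_ , _ , refl) = s≤s z≤n
  open Bounds n a b n≡ a<b (m<n⇒0<n∸m b<n) {⟦ T ⟧} T⇒∈ ∈⇒T positive small ws
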